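{- Let $n\ge 1$. For each alternating sign matrix $A=(a_{ij})\in\mathcal{A}_n$, $$\beta(A)=\sum_{\substack{1\le i<j\le n\\ 1\le k<l\le n}}(l-k)\,a_{jk}\,a_{il}.$$
   Context: An $n\times n$ matrix $A=(a_{ij})$ is an alternating sign matrix (ASM) if for all $i,j$: $a_{ij}\in\{ -1,0,1\}$, $\sum_{k=1}^{j}a_{ik}\in\{0,1\}$, $\sum_{k=1}^{i}a_{kj}\in\{0,1\}$, and $\sum_{k=1}^{n}a_{ik}=\sum_{k=1}^{n}a_{kj}=1$. $\mathcal{A}_n$ is the set of all ASMs of size $n$. The symmetric group $S_n$ is regarded as a subset of $\mathcal{A}_n$ by identifying $w\in S_n$ with its permutation matrix $(w_{ij})$, where $w_{ij}=1$ if $j=w(i)$ and $w_{ij}=0$ otherwise. The corner sum matrix of $A\in\mathcal{A}_n$ is $\widetilde{A}(i,j)=\sum_{p\le i,\,q\le j}a_{pq}$. The ASM order on $\mathcal{A}_n$ is: $A\le B$ iff $\widetilde{A}(i,j)\ge\widetilde{B}(i,j)$ for all $i,j$. A permutation $v\in S_n$ is bigrassmannian if there exists a unique pair $(i,j)$, with $1\le i,j\le n-1$, such that $v^{ -1}(i)>v^{ -1}(i+1)$ and $v(j)>v(j+1)$. (It is known that the bigrassmannian permutations are exactly the join-irreducible elements of $(\mathcal{A}_n,\le)$, i.e. the ASMs covering exactly one element.) For $B\in\mathcal{A}_n$, $\beta(B)=|\{A\in\mathcal{A}_n \mid A\le B \text{ and } A \text{ is bigrassmannian}\}|$. -}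

module Defs where

open import Data.Bool.Base using (if_then_else_)
open import Data.Fin.Base as Fin using (Fin; toℕ)
open import Data.Fin.Permutation using (Permutation′; _⟨$⟩ʳ_; _⟨$⟩ˡ_)
import Data.Fin.Properties as Fin
open import Data.Integer.Base using (ℤ; +_; 0ℤ; 1ℤ; -1ℤ; _≥_)
open import Data.Integer.Properties using (+-0-commutativeMonoid)
open import Data.Nat.Base using (ℕ; suc)
open import Data.Product.Base using (∃-syntax; _×_; _,_; proj₁)
open import Data.Product using (∃!)
open import Data.Sum.Base using (_⊎_)
open import Data.Vec.Functional using (Vector)
import Data.Vec.Functional.Relation.Binary.Equality.Setoid as VecEq
open import Function.Bundles using (Bijection)
open import Level using (Level; 0ℓ; _⊔_)
open import Relation.Binary.Bundles using (Setoid)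
import Relation.Binary.Construct.On as On
open import Relation.Binary.PropositionalEquality using (_≡_; setoid)
open import Relation.Nullary.Decidable using (Dec; does; _×-dec_)

open import Algebra.Properties.CommutativeMonoid.Sum +-0-commutativeMonoid public
  using (sum-syntax)

private
  variable
    n : ℕ

-- Restricts the range of a sum: terms failing the condition become 0.
infix 3 _when_

_when_ : {P : Set} → ℤ → Dec P → ℤ
x when P? = if does P? then x else 0ℤ

Matrix : ℕ → Set
Matrix n = Vector (Vector ℤ n) n

-- The indices 1, …, n are represented by Fin n, shifted down by one, so
-- "k ≤ j" below is the inclusive range k = 1, …, j.
rowPartialSum colPartialSum : Matrix n → Matrix n
rowPartialSum {n} a i j = ∑[ k < n ] (a i k when k Fin.≤? j)
colPartialSum {n} a i j = ∑[ k < n ] (a k j when k Fin.≤? i)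

record IsASM (a : Matrix n) : Set where
  field
    entries         : ∀ i j → a i j ≡ -1ℤ ⊎ a i j ≡ 0ℤ ⊎ a i j ≡ 1ℤ
    rowPartialSums  : ∀ i j → rowPartialSum a i j ≡ 0ℤ ⊎ rowPartialSum a i j ≡ 1ℤ
    colPartialSums  : ∀ i j → colPartialSum a i j ≡ 0ℤ ⊎ colPartialSum a i j ≡ 1ℤ
    rowSums         : ∀ i → ∑[ k < n ] a i k ≡ 1ℤ
    colSums         : ∀ j → ∑[ k < n ] a k j ≡ 1ℤ

record ASM (n : ℕ) : Set where
  constructor mkASM
  field
    entry : Matrix n
    isASM : IsASM entry

open ASM public

-- Two ASMs are equal when they have the same entries.
ASM-setoid : ℕ → Setoid 0ℓ 0ℓ
ASM-setoid n = On.setoid (VecEq.≋-setoid (VecEq.≋-setoid (setoid ℤ) n) n) (entry {n})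

cornerSum : Matrix n → Matrix n
cornerSum {n} a i j =
  ∑[ p < n ] ∑[ q < n ] (a p q when (p Fin.≤? i ×-dec q Fin.≤? j))

-- Note the reversal: larger ASMs have smaller corner sums.
infix 4 _≤ᴬ_

_≤ᴬ_ : ASM n → ASM n → Set
A ≤ᴬ B = ∀ i j → cornerSum (entry A) i j ≥ cornerSum (entry B) i j

permutationMatrix : Permutation′ n → Matrix n
permutationMatrix w i j = 1ℤ when (j Fin.≟ w ⟨$⟩ʳ i)

-- f(j) > f(j+1); the existence of j′ = j+1 in Fin n encodes 1 ≤ j ≤ n-1.
Descent : (Fin n → Fin n) → Fin n → Set
Descent f j = ∃[ j′ ] (toℕ j′ ≡ suc (toℕ j) × f j Fin.> f j′)

Bigrassmannian : Permutation′ n → Set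
Bigrassmannian {n} v =
  ∃! {A = Fin n × Fin n} _≡_ λ (i , j) → Descent (v ⟨$⟩ˡ_) i × Descent (v ⟨$⟩ʳ_) j

IsBigrassmannian : ASM n → Set
IsBigrassmannian {n} A =
  ∃[ v ] (Bigrassmannian {n} v × (∀ i j → entry A i j ≡ permutationMatrix v i j))

-- The set { A ∈ 𝒜ₙ ∣ A ≤ B and A is bigrassmannian }; its elements are
-- compared as ASMs, ignoring the accompanying proofs.
BigrassmannianBelow : ASM n → Setoid 0ℓ 0ℓ
BigrassmannianBelow {n} B =
  On.setoid {B = ∃[ A ] (A ≤ᴬ B × IsBigrassmannian A)} (ASM-setoid n) proj₁

HasCardinality : {c ℓ : Level} → Setoid c ℓ → ℕ → Set (c ⊔ ℓ)
HasCardinality S m = Bijection (setoid (Fin m)) S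

-- "β(B) exists and equals x": x is the number of elements of the finite
-- set BigrassmannianBelow B.
infix 4 β_≐_

β_≐_ : ASM n → ℤ → Set
β B ≐ x = ∃[ m ] (HasCardinality (BigrassmannianBelow B) m × + m ≡ x)

{-# OPTIONS --safe #-}

-- A bigrassmannian permutation with row descent l and column descent k increases on both sides
-- of these descents. This forces its corner sums to be the largest ones compatible with the
-- value r at (l, k), namely c(p, q) = min (p, q, r + (p - l)⁺ + (q - k)⁺), since every ASM has
-- corner sums which grow by 0 or 1 in each step. So it is determined by (k, l, r), and it lies
-- below B exactly if the corner sum of B at (l, k) is at most r. The possible r are those below
-- min (l, k), whence β(B) = Σ_{k, l} (min (l, k) - B̃(l, k)).
-- On the other side, writing l - k as the number of t with k ≤ t < l turns the right-hand sum
-- into Σ_t Σ_{i < j} R_j (1 - R_i), where R_i is the t-th partial sum of row i. The R_i form a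
-- 0/1 sequence with sum t, and its number of inversions is Σ_i (min (i, t) - (R_1 + … + R_i)).
module Submission where

open import Defs
open import Data.Bool.Base using (true; false; if_then_else_)
open import Data.Fin.Base as Fin using (Fin; zero; suc; toℕ; fromℕ<; _↑ˡ_; _↑ʳ_; splitAt)
open import Data.Fin.Permutation as Perm using (Permutation′; _⟨$⟩ʳ_; _⟨$⟩ˡ_)
open import Data.Fin.Properties as Fin using (_<?_)
open import Data.Integer.Base as ℤ using (ℤ; +_; _+_; _-_; _*_; 0ℤ; 1ℤ; ∣_∣)
import Data.Integer.Properties as ℤ
open import Data.Integer.Tactic.RingSolver using (solve-∀)
open import Data.Nat.Base as ℕ using (ℕ; zero; suc; _≥_; _⊓_; _≤_; _<_; _∸_; z≤n; s≤s; s≤s⁻¹)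
import Data.Nat.Properties as ℕ
open import Data.Product.Base using (Σ; Σ-syntax; ∃-syntax; _×_; _,_; proj₁; proj₂; map)
open import Data.Sum.Base using (_⊎_; inj₁; inj₂)
open import Function.Base using (_∘_; flip; id)
open import Function.Bundles using (_↔_; Inverse; mk↔ₛ′; mk⇔)
open import Function.Construct.Identity using (↔-id)
open import Relation.Binary.Bundles using (Setoid)
open import Relation.Binary.Definitions using (tri<; tri≈; tri>)
open import Relation.Binary.PropositionalEquality
open import Relation.Nullary.Decidable
  using (Dec; does; yes; no; _×-dec_; does-⇔; dec-true; dec-false)
open import Relation.Nullary.Negation using (contradiction; ¬_)

open import Algebra.Properties.AbelianGroup ℤ.+-0-abelianGroup
  using () renaming (∙-cancelʳ to +-cancelʳ)
open import Algebra.Properties.CommutativeMonoid.Sum ℤ.+-0-commutativeMonoid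
  using (sum; sum-cong-≗; ∑-comm; sum-replicate-zero; ∑-distrib-+)
import Algebra.Properties.CommutativeMonoid.Sum ℕ.+-0-commutativeMonoid as ℕ-Sum
import Algebra.Properties.Semiring.Sum ℤ.+-*-semiring as Semiring

private
  variable
    m n : ℕ

-- Sums and truncated sums of integer vectors

sum-cong : {f g : Fin n → ℤ} → f ≗ g → sum f ≡ sum g
sum-cong {n} {f} {g} = sum-cong-≗ {n} {f} {g}

*-distribˡ-∑ : ∀ x (f : Fin n → ℤ) → x * sum f ≡ ∑[ i < n ] (x * f i)
*-distribˡ-∑ = Semiring.*-distribˡ-sum

when-cong : {P : Set} {x y : ℤ} (P? : Dec P) → x ≡ y → (x when P?) ≡ (y when P?)
when-cong P? refl = refl

when-× : {P Q : Set} (x : ℤ) (P? : Dec P) (Q? : Dec Q) →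
         (x when (P? ×-dec Q?)) ≡ ((x when Q?) when P?)
when-× x P? Q? with does P?
... | true  = refl
... | false = refl

sum-when : {P : Set} (f : Fin n → ℤ) (P? : Dec P) → ∑[ i < n ] (f i when P?) ≡ (sum f when P?)
sum-when {n} f P? with does P?
... | true  = refl
... | false = sum-replicate-zero n

-- The cut-off is a natural number, so that the empty sum is included and every `p` beyond `n` gives
-- the full sum.
prefix : (Fin n → ℤ) → ℕ → ℤ
prefix {zero}  f p       = 0ℤ
prefix {suc n} f zero    = 0ℤ
prefix {suc n} f (suc p) = f zero + prefix (f ∘ suc) p

prefix-cong : {f g : Fin n → ℤ} → f ≗ g → ∀ p → prefix f p ≡ prefix g p
prefix-cong {zero}  f≗g p       = refl
prefix-cong {suc n} f≗g zero    = refl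
prefix-cong {suc n} f≗g (suc p) = cong₂ _+_ (f≗g zero) (prefix-cong (f≗g ∘ suc) p)

prefix-zero : (f : Fin n → ℤ) → prefix f 0 ≡ 0ℤ
prefix-zero {zero}  f = refl
prefix-zero {suc n} f = refl

prefix-0s : ∀ n p → prefix {n} (λ _ → 0ℤ) p ≡ 0ℤ
prefix-0s zero    p       = refl
prefix-0s (suc n) zero    = refl
prefix-0s (suc n) (suc p) = trans (ℤ.+-identityˡ _) (prefix-0s n p)

+-interchange : ∀ a b c d → (a + b) + (c + d) ≡ (a + c) + (b + d)
+-interchange = solve-∀

prefix-+ : ∀ (f g : Fin n → ℤ) p → prefix (λ i → f i + g i) p ≡ prefix f p + prefix g p
prefix-+ {zero}  f g p       = refl
prefix-+ {suc n} f g zero    = refl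
prefix-+ {suc n} f g (suc p) = trans (cong (_+_ (f zero + g zero)) (prefix-+ (f ∘ suc) (g ∘ suc) p))
                                     (+-interchange (f zero) (g zero) _ _)

prefix-swap : ∀ (a : Fin m → Fin n → ℤ) p q →
              prefix (λ i → prefix (a i) q) p ≡ prefix (λ j → prefix (λ i → a i j) p) q
prefix-swap {zero}  {n} a p       q = sym (prefix-0s n q)
prefix-swap {suc m} {n} a zero    q = sym (prefix-0s n q)
prefix-swap {suc m} a (suc p) q =
  trans (cong (_+_ (prefix (a zero) q)) (prefix-swap (a ∘ suc) p q))
        (sym (prefix-+ (a zero) (λ j → prefix (λ i → a (suc i) j) p) q))

prefix-total : ∀ (f : Fin n → ℤ) {p} → n ≤ p → prefix f p ≡ sum f
prefix-total {zero}  f n≤p       = refl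
prefix-total {suc n} f (s≤s n≤p) = cong (_+_ (f zero)) (prefix-total (f ∘ suc) n≤p)

prefix-suc : ∀ (f : Fin n → ℤ) i → prefix f (suc (toℕ i)) ≡ f i + prefix f (toℕ i)
prefix-suc f zero    = cong (_+_ (f zero)) (prefix-zero (f ∘ suc))
prefix-suc f (suc i) = trans (cong (_+_ (f zero)) (prefix-suc (f ∘ suc) i)) (swap (f zero) (f (suc i)) _)
  where
  swap : ∀ a b c → a + (b + c) ≡ b + (a + c)
  swap = solve-∀

-- The entries are the differences of consecutive truncated sums.
prefix-injective : ∀ {f g : Fin n → ℤ} → (∀ p → p ≤ n → prefix f p ≡ prefix g p) → f ≗ g
prefix-injective {f = f} {g} eq i = +-cancelʳ (prefix f (toℕ i)) (f i) (g i) (begin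
  f i + prefix f (toℕ i)  ≡⟨ prefix-suc f i ⟨
  prefix f (suc (toℕ i))  ≡⟨ eq _ (Fin.toℕ<n i) ⟩
  prefix g (suc (toℕ i))  ≡⟨ prefix-suc g i ⟩
  g i + prefix g (toℕ i)  ≡⟨ cong (_+_ (g i)) (eq _ (ℕ.<⇒≤ (Fin.toℕ<n i))) ⟨
  g i + prefix f (toℕ i)  ∎)
  where open ≡-Reasoning

-- Passes from inclusive to strict cut-offs; equality of the Booleans is enough, as `_when_` looks
-- at nothing else.
does-≤? : ∀ p q → does (p ℕ.≤? q) ≡ does (p ℕ.<? suc q)
does-≤? zero    q = refl
does-≤? (suc p) q = refl

sum-<? : ∀ (f : Fin n → ℤ) p → ∑[ k < n ] (f k when (toℕ k ℕ.<? p)) ≡ prefix f p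
sum-<? {zero}  f p       = refl
sum-<? {suc n} f zero    = sum-replicate-zero (suc n)
sum-<? {suc n} f (suc p) = cong (_+_ (f zero)) (sum-<? (f ∘ suc) p)

sum-≤? : ∀ (f : Fin n → ℤ) (j : Fin m) → ∑[ k < n ] (f k when (k Fin.≤? j)) ≡ prefix f (suc (toℕ j))
sum-≤? {n} f j = trans
  (sum-cong {n} λ k → cong (λ b → if b then f k else 0ℤ) (does-≤? (toℕ k) (toℕ j)))
  (sum-<? f (suc (toℕ j)))

Bit : ℤ → Set
Bit x = x ≡ 0ℤ ⊎ x ≡ 1ℤ

prefix-bits : ∀ {f : Fin n → ℤ} → (∀ i → Bit (f i)) → ∀ p →
              prefix f (suc p) ≡ prefix f p ⊎ prefix f (suc p) ≡ ℤ.suc (prefix f p)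
prefix-bits {zero}  bits p = inj₁ refl
prefix-bits {suc n} {f} bits zero with bits zero
... | inj₁ f0≡0 = inj₁ (cong₂ _+_ f0≡0 (prefix-zero (f ∘ suc)))
... | inj₂ f0≡1 = inj₂ (cong₂ _+_ f0≡1 (prefix-zero (f ∘ suc)))
prefix-bits {suc n} {f} bits (suc p) with prefix-bits (bits ∘ suc) p
... | inj₁ eq = inj₁ (cong (_+_ (f zero)) eq)
... | inj₂ eq = inj₂ (trans (cong (_+_ (f zero)) eq) (swap (f zero) (prefix (f ∘ suc) p)))
  where
  swap : ∀ a b → a + (1ℤ + b) ≡ 1ℤ + (a + b)
  swap = solve-∀

prefix-bits-nonneg : ∀ {f : Fin n → ℤ} → (∀ i → Bit (f i)) → ∀ p → 0ℤ ℤ.≤ prefix f p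
prefix-bits-nonneg {f = f} bits zero = ℤ.≤-reflexive (sym (prefix-zero f))
prefix-bits-nonneg bits (suc p) with prefix-bits bits p
... | inj₁ eq = ℤ.≤-trans (prefix-bits-nonneg bits p) (ℤ.≤-reflexive (sym eq))
... | inj₂ eq = ℤ.≤-trans (prefix-bits-nonneg bits p)
                  (ℤ.≤-trans (ℤ.i≤suc[i] _) (ℤ.≤-reflexive (sym eq)))

-- Weighted inversions as corner sum defects

-- Both sides are g 0 + ... + g n.
sum-telescope : ∀ n (g : ℕ → ℤ) →
  g 0 + ∑[ i < n ] g (suc (toℕ i)) ≡ ∑[ i < n ] g (toℕ i) + g n
sum-telescope zero    g = ℤ.+-comm (g 0) 0ℤ
sum-telescope (suc n) g = trans (cong (_+_ (g 0)) (sum-telescope n (g ∘ suc)))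
                                (sym (ℤ.+-assoc (g 0) _ _))

-- Summation by parts: `y l` occurs once in `sum y` and once in the suffix after t for each t < l.
suffixSum : ∀ (y : Fin n → ℤ) →
  ∑[ l < n ] (+ suc (toℕ l) * y l) ≡ sum y + ∑[ t < n ] (sum y - prefix y (suc (toℕ t)))
suffixSum {zero}  y = refl
suffixSum {suc n} y = begin
  1ℤ * y zero + ∑[ l < n ] (+ suc (suc (toℕ l)) * y (suc l))
    ≡⟨ cong₂ _+_ (ℤ.*-identityˡ (y zero)) (sum-cong λ l → ℤ.suc-* (+ suc (toℕ l)) (y (suc l))) ⟩
  y zero + ∑[ l < n ] (y (suc l) + + suc (toℕ l) * y (suc l))
    ≡⟨ cong (_+_ (y zero)) (∑-distrib-+ (y ∘ suc) (λ l → + suc (toℕ l) * y (suc l))) ⟩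
  y zero + (Y + ∑[ l < n ] (+ suc (toℕ l) * y (suc l)))
    ≡⟨ cong (λ z → y zero + (Y + z)) (suffixSum (y ∘ suc)) ⟩
  y zero + (Y + (Y + S))
    ≡⟨ regroup (y zero) Y S ⟩
  (y zero + Y) + ((y zero + Y - (y zero + 0ℤ)) + S)
    ≡⟨ cong₂ (λ u v → (y zero + Y) + ((y zero + Y - (y zero + u)) + v))
         (sym (prefix-zero (y ∘ suc))) (sum-cong {n} λ t → cancel (y zero) Y (prefix (y ∘ suc) (suc (toℕ t)))) ⟩
  (y zero + Y) + ((y zero + Y - (y zero + prefix (y ∘ suc) 0)) +
    ∑[ t < n ] ((y zero + Y) - (y zero + prefix (y ∘ suc) (suc (toℕ t))))) ∎
  where
  open ≡-Reasoning
  Y = sum (y ∘ suc)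
  S = ∑[ t < n ] (Y - prefix (y ∘ suc) (suc (toℕ t)))
  regroup : ∀ a b c → a + (b + (b + c)) ≡ (a + b) + ((a + b - (a + 0ℤ)) + c)
  regroup = solve-∀
  cancel : ∀ a b c → b - c ≡ (a + b) - (a + c)
  cancel = solve-∀

-- l - k counts the t with k ≤ t < l.
weightedPairs : ∀ (x y : Fin n → ℤ) →
  ∑[ k < n ] ∑[ l < n ] ((+ toℕ l - + toℕ k) * x k * y l when (k <? l)) ≡
  ∑[ t < n ] (prefix x (suc (toℕ t)) * (sum y - prefix y (suc (toℕ t))))
weightedPairs {zero}  x y = refl
weightedPairs {suc n} x y = begin
  (0ℤ + ∑[ l < n ] ((+ suc (toℕ l) - 0ℤ) * x₀ * y (suc l))) +
    ∑[ k < n ] (0ℤ + ∑[ l < n ] ((+ suc (toℕ l) - + suc (toℕ k)) * x (suc k) * y (suc l) when (k <? l)))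
    ≡⟨ cong₂ _+_ (trans (ℤ.+-identityˡ _) (sum-cong λ l → first (+ suc (toℕ l)) x₀ (y (suc l))))
         (sum-cong λ k → trans (ℤ.+-identityˡ _) (sum-cong λ l → when-cong (k <? l)
           (shift (+ toℕ l) (+ toℕ k) (x (suc k)) (y (suc l))))) ⟩
  ∑[ l < n ] (x₀ * (+ suc (toℕ l) * y (suc l))) +
    ∑[ k < n ] ∑[ l < n ] ((+ toℕ l - + toℕ k) * x (suc k) * y (suc l) when (k <? l))
    -- The pairs with k = 0 put the weights 1, 2, ... on the tail of `y`, which is the situation of
    -- `suffixSum`; the other pairs fall under the induction hypothesis.
    ≡⟨ cong₂ _+_ (trans (sym (*-distribˡ-∑ x₀ (λ l → + suc (toℕ l) * y (suc l))))
                        (cong (x₀ *_) (suffixSum (y ∘ suc))))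
         (weightedPairs (x ∘ suc) (y ∘ suc)) ⟩
  x₀ * (Y + ∑[ t < n ] (Y - q t)) + ∑[ t < n ] (p t * (Y - q t))
    ≡⟨ cong (_+ ∑[ t < n ] (p t * (Y - q t))) (trans (ℤ.*-distribˡ-+ x₀ Y _)
         (cong (_+_ (x₀ * Y)) (*-distribˡ-∑ x₀ (λ t → Y - q t)))) ⟩
  (x₀ * Y + ∑[ t < n ] (x₀ * (Y - q t))) + ∑[ t < n ] (p t * (Y - q t))
    ≡⟨ trans (ℤ.+-assoc (x₀ * Y) _ _)
         (cong (_+_ (x₀ * Y)) (sym (∑-distrib-+ (λ t → x₀ * (Y - q t)) (λ t → p t * (Y - q t))))) ⟩
  x₀ * Y + ∑[ t < n ] (x₀ * (Y - q t) + p t * (Y - q t))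
    -- The extra `x₀ * Y` becomes the term at t = 0, whose prefixes consist of the first entry
    -- alone.
    ≡⟨ cong₂ _+_ (trans (head′ x₀ y₀ Y) (cong₂ (λ u v → (x₀ + u) * (y₀ + Y - (y₀ + v)))
           (sym (prefix-zero (x ∘ suc))) (sym (prefix-zero (y ∘ suc)))))
         (sum-cong λ t → tail′ x₀ y₀ Y (p t) (q t)) ⟩
  (x₀ + prefix (x ∘ suc) 0) * (y₀ + Y - (y₀ + prefix (y ∘ suc) 0)) +
    ∑[ t < n ] ((x₀ + p t) * (y₀ + Y - (y₀ + q t))) ∎
  where
  open ≡-Reasoning
  x₀ = x zero
  y₀ = y zero
  Y = sum (y ∘ suc)
  p q : Fin n → ℤ
  p t = prefix (x ∘ suc) (suc (toℕ t))
  q t = prefix (y ∘ suc) (suc (toℕ t))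
  first : ∀ a b c → (a - 0ℤ) * b * c ≡ b * (a * c)
  first = solve-∀
  shift : ∀ a b c d → ((1ℤ + a) - (1ℤ + b)) * c * d ≡ (a - b) * c * d
  shift = solve-∀
  head′ : ∀ a b c → a * c ≡ (a + 0ℤ) * (b + c - (b + 0ℤ))
  head′ = solve-∀
  tail′ : ∀ a b c d e → a * (c - e) + d * (c - e) ≡ (a + d) * (b + c - (b + e))
  tail′ = solve-∀

sum-bits-≤ : ∀ {ρ : Fin n → ℤ} → (∀ i → Bit (ρ i)) → ∃[ T ] (T ≤ n × sum ρ ≡ + T)
sum-bits-≤ {zero}  bits = 0 , z≤n , refl
sum-bits-≤ {suc n} bits with sum-bits-≤ (bits ∘ suc) | bits zero
... | T , T≤n , eq | inj₁ ρ₀≡0 = T     , ℕ.m≤n⇒m≤1+n T≤n , cong₂ _+_ ρ₀≡0 eq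
... | T , T≤n , eq | inj₂ ρ₀≡1 = suc T , s≤s T≤n         , cong₂ _+_ ρ₀≡1 eq

-- For a 0/1 sequence the summand is 1 exactly if a 0 at i precedes a 1 at j.
inversions : (Fin n → ℤ) → ℤ
inversions {n} ρ = ∑[ i < n ] ∑[ j < n ] (ρ j * (1ℤ - ρ i) when (i <? j))

inversions-cons : ∀ (ρ : Fin (suc n) → ℤ) →
  inversions ρ ≡ (1ℤ - ρ zero) * sum (ρ ∘ suc) + inversions (ρ ∘ suc)
inversions-cons {n} ρ = cong₂ _+_
  (trans (ℤ.+-identityˡ _) (trans (sum-cong λ j → ℤ.*-comm (ρ (suc j)) (1ℤ - ρ zero))
     (sym (*-distribˡ-∑ (1ℤ - ρ zero) (ρ ∘ suc)))))
  (sum-cong λ i → ℤ.+-identityˡ (∑[ j < n ] (ρ (suc j) * (1ℤ - ρ (suc i)) when (i <? j))))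

-- The last term of the telescoping sum, min (n + 1, T), is T.
sum-min-suc : ∀ {T} → T ≤ n →
  + (1 ⊓ T) + ∑[ i < n ] (+ (suc (suc (toℕ i)) ⊓ T)) ≡ ∑[ i < n ] (+ (suc (toℕ i) ⊓ T)) + + T
sum-min-suc {n} {T} T≤n = trans (sum-telescope n (λ i → + (suc i ⊓ T)))
  (cong (λ z → ∑[ i < n ] (+ (suc (toℕ i) ⊓ T)) + + z) (ℕ.m≥n⇒m⊓n≡n (ℕ.m≤n⇒m≤1+n T≤n)))

sum-sub : ∀ (f g : Fin n → ℤ) → ∑[ i < n ] (f i - g i) ≡ sum f - sum g
sum-sub {zero}  f g = refl
sum-sub {suc n} f g = trans (cong (_+_ (f zero - g zero)) (sum-sub (f ∘ suc) (g ∘ suc)))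
                            (regroup (f zero) (g zero) _ _)
  where
  regroup : ∀ a b c d → (a - b) + (c - d) ≡ (a + c) - (b + d)
  regroup = solve-∀

-- The minima are the prefix sums of 1...10...0, which has no inversions. In the induction, a
-- leading 0 is inverted with each of the T ones behind it. A leading 1 adds no inversion and raises
-- all later minima and prefix sums by 1 alike.
inversions-bits : ∀ {ρ : Fin n → ℤ} → (∀ i → Bit (ρ i)) → ∀ {T} → sum ρ ≡ + T →
  inversions ρ ≡ ∑[ i < n ] (+ (suc (toℕ i) ⊓ T) - prefix ρ (suc (toℕ i)))
inversions-bits {zero}  bits eq = refl
inversions-bits {suc n} {ρ} bits {T} eq
  with sum-bits-≤ (bits ∘ suc) | bits zero
... | T′ , T′≤n , eq′ | inj₁ ρ₀≡0
  with refl ← ℤ.+-injective (trans (sym eq) (cong₂ _+_ ρ₀≡0 eq′)) = begin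
  inversions ρ
    ≡⟨ inversions-cons ρ ⟩
  (1ℤ - ρ zero) * sum ρ′ + inversions ρ′
    ≡⟨ cong₂ (λ u v → (1ℤ - u) * v + inversions ρ′) ρ₀≡0 eq′ ⟩
  1ℤ * + T + inversions ρ′
    ≡⟨ cong₂ _+_ (ℤ.*-identityˡ (+ T)) (trans (inversions-bits (bits ∘ suc) eq′) (sum-sub M P)) ⟩
  + T + (sum M - sum P)
    ≡⟨ move (+ T) (sum M) (sum P) ⟩
  (sum M + + T) - sum P
    -- The T new inversions are exactly what the sum of the minima gains when the sequence becomes
    -- longer by one.
    ≡⟨ cong (_- sum P) (sum-min-suc T′≤n) ⟨
  (+ (1 ⊓ T) + sum M⁺) - sum P
    ≡⟨ split (+ (1 ⊓ T)) (sum M⁺) (sum P) ⟩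
  (+ (1 ⊓ T) - (0ℤ + 0ℤ)) + (sum M⁺ - sum P)
    ≡⟨ cong₂ _+_ (cong₂ (λ u v → + (1 ⊓ T) - (u + v)) (sym ρ₀≡0) (sym (prefix-zero ρ′))) (begin
      sum M⁺ - sum P                           ≡⟨ sum-sub M⁺ P ⟨
      ∑[ i < n ] (M⁺ i - P i)                  ≡⟨ sum-cong {n} (λ i → cong (M⁺ i -_) (sym (ℤ.+-identityˡ (P i)))) ⟩
      ∑[ i < n ] (M⁺ i - (0ℤ + P i))           ≡⟨ cong (λ u → ∑[ i < n ] (M⁺ i - (u + P i))) ρ₀≡0 ⟨
      ∑[ i < n ] (M⁺ i - (ρ zero + P i))       ∎) ⟩
  ∑[ i < suc n ] (+ (suc (toℕ i) ⊓ T) - prefix ρ (suc (toℕ i))) ∎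
  where
  open ≡-Reasoning
  ρ′ M M⁺ P : Fin n → ℤ
  ρ′ = ρ ∘ suc
  M i = + (suc (toℕ i) ⊓ T)
  M⁺ i = + (suc (suc (toℕ i)) ⊓ T)
  P i = prefix ρ′ (suc (toℕ i))
  move : ∀ a b c → a + (b - c) ≡ (b + a) - c
  move = solve-∀
  split : ∀ a b c → (a + b) - c ≡ (a - (0ℤ + 0ℤ)) + (b - c)
  split = solve-∀
... | T′ , T′≤n , eq′ | inj₂ ρ₀≡1
  with refl ← ℤ.+-injective (trans (sym eq) (cong₂ _+_ ρ₀≡1 eq′)) = begin
  inversions ρ
    ≡⟨ inversions-cons ρ ⟩
  (1ℤ - ρ zero) * sum ρ′ + inversions ρ′
    ≡⟨ cong (λ u → (1ℤ - u) * sum ρ′ + inversions ρ′) ρ₀≡1 ⟩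
  0ℤ * sum ρ′ + inversions ρ′
    ≡⟨ cong₂ _+_ (ℤ.*-zeroˡ (sum ρ′)) (inversions-bits (bits ∘ suc) eq′) ⟩
  (1ℤ - (1ℤ + 0ℤ)) + ∑[ i < n ] (M i - P i)
    ≡⟨ cong₂ _+_ (cong₂ (λ u v → 1ℤ - (u + v)) (sym ρ₀≡1) (sym (prefix-zero ρ′))) (begin
      ∑[ i < n ] (M i - P i)                           ≡⟨ sum-cong {n} (λ i → shift (M i) (P i)) ⟩
      ∑[ i < n ] ((1ℤ + M i) - (1ℤ + P i))             ≡⟨ cong (λ u → ∑[ i < n ] ((1ℤ + M i) - (u + P i))) ρ₀≡1 ⟨
      ∑[ i < n ] ((1ℤ + M i) - (ρ zero + P i))         ∎) ⟩
  ∑[ i < suc n ] (+ (suc (toℕ i) ⊓ suc T′) - prefix ρ (suc (toℕ i))) ∎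
  where
  open ≡-Reasoning
  ρ′ M P : Fin n → ℤ
  ρ′ = ρ ∘ suc
  M i = + (suc (toℕ i) ⊓ T′)
  P i = prefix ρ′ (suc (toℕ i))
  shift : ∀ a b → a - b ≡ (1ℤ + a) - (1ℤ + b)
  shift = solve-∀

-- Corner sums of an ASM

corner : Matrix n → ℕ → ℕ → ℤ
corner a p q = prefix (λ i → prefix (a i) q) p

-- `corner` is indexed by the numbers of rows and columns, `cornerSum` by the last row and column
-- included; hence the successors.
cornerSum≡corner : ∀ (a : Matrix n) i j → cornerSum a i j ≡ corner a (suc (toℕ i)) (suc (toℕ j))
cornerSum≡corner {n} a i j = begin
  ∑[ p < n ] ∑[ q < n ] (a p q when (p Fin.≤? i ×-dec q Fin.≤? j))
    ≡⟨ sum-cong {n} (λ p → trans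
         (sum-cong {n} λ q → when-× (a p q) (p Fin.≤? i) (q Fin.≤? j))
         (sum-when (λ q → a p q when (q Fin.≤? j)) (p Fin.≤? i))) ⟩
  ∑[ p < n ] (rowPartialSum a p j when (p Fin.≤? i))
    ≡⟨ sum-cong {n} (λ p → when-cong (p Fin.≤? i) (sum-≤? (a p) j)) ⟩
  ∑[ p < n ] (prefix (a p) (suc (toℕ j)) when (p Fin.≤? i))
    ≡⟨ sum-≤? (λ p → prefix (a p) (suc (toℕ j))) i ⟩
  corner a (suc (toℕ i)) (suc (toℕ j)) ∎
  where open ≡-Reasoning

corner-transpose : ∀ (a : Matrix n) p q → corner a p q ≡ corner (flip a) q p
corner-transpose a p q = prefix-swap a p q

prefix-1s : ∀ {p} → p ≤ n → prefix {n} (λ _ → 1ℤ) p ≡ + p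
prefix-1s {n} z≤n = prefix-zero {n} (λ _ → 1ℤ)
prefix-1s (s≤s p≤n) = cong ℤ.suc (prefix-1s p≤n)

-- Extends the partial sum conditions of an ASM to all cut-offs: the empty one gives 0, and those
-- beyond `n` give the full sum.
prefix-bit : ∀ {f : Fin n → ℤ} → (∀ j → Bit (prefix f (suc (toℕ j)))) → Bit (sum f) →
             ∀ p → Bit (prefix f p)
prefix-bit {f = f} bits bit zero = inj₁ (prefix-zero f)
prefix-bit {n} {f} bits bit (suc p) with p ℕ.<? n
... | yes p<n = subst (λ k → Bit (prefix f (suc k))) (Fin.toℕ-fromℕ< p<n) (bits (fromℕ< p<n))
... | no  p≮n = subst Bit (sym (prefix-total f (ℕ.m≤n⇒m≤1+n (ℕ.≮⇒≥ p≮n)))) bit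

module _ (A : ASM n) where

  open IsASM (isASM A)

  private
    a : Matrix n
    a = entry A

  row-bit : ∀ i q → Bit (prefix (a i) q)
  row-bit i = prefix-bit (λ j → subst Bit (sum-≤? (a i) j) (rowPartialSums i j)) (inj₂ (rowSums i))

  col-bit : ∀ j p → Bit (prefix (λ i → a i j) p)
  col-bit j = prefix-bit (λ i → subst Bit (sum-≤? (λ k → a k j) i) (colPartialSums i j))
                         (inj₂ (colSums j))

  corner-full-cols : ∀ {p} → p ≤ n → corner a p n ≡ + p
  corner-full-cols {p} p≤n =
    trans (prefix-cong (λ i → trans (prefix-total (a i) ℕ.≤-refl) (rowSums i)) p) (prefix-1s p≤n)

  corner-full-rows : ∀ {q} → q ≤ n → corner a n q ≡ + q
  corner-full-rows {q} q≤n = trans (corner-transpose a n q)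
    (trans (prefix-cong (λ j → trans (prefix-total (λ i → a i j) ℕ.≤-refl) (colSums j)) q)
           (prefix-1s q≤n))

  weightedInversions≡cornerDefects :
    ∑[ i < n ] ∑[ j < n ] ∑[ k < n ] ∑[ l < n ]
      ((+ toℕ l - + toℕ k) * a j k * a i l when (i <? j ×-dec k <? l)) ≡
    ∑[ t < n ] ∑[ i < n ] (+ (suc (toℕ i) ⊓ suc (toℕ t)) - corner a (suc (toℕ i)) (suc (toℕ t)))
  weightedInversions≡cornerDefects = begin
    ∑[ i < n ] ∑[ j < n ] ∑[ k < n ] ∑[ l < n ] (w j k i l when (i <? j ×-dec k <? l))
      ≡⟨ sum-cong {n} (λ i → sum-cong {n} (perPair i)) ⟩
    ∑[ i < n ] ∑[ j < n ] ∑[ t < n ] (R t j * (1ℤ - R t i) when (i <? j))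
      ≡⟨ sum-cong {n} (λ i → ∑-comm (λ j t → R t j * (1ℤ - R t i) when (i <? j))) ⟩
    ∑[ i < n ] ∑[ t < n ] ∑[ j < n ] (R t j * (1ℤ - R t i) when (i <? j))
      ≡⟨ ∑-comm (λ i t → ∑[ j < n ] (R t j * (1ℤ - R t i) when (i <? j))) ⟩
    ∑[ t < n ] inversions (R t)
      -- `R t` has sum t + 1, because each of the first t + 1 columns has sum 1.
      ≡⟨ sum-cong {n} (λ t → inversions-bits {ρ = R t} (λ i → row-bit i (suc (toℕ t)))
           (trans (sym (prefix-total (R t) ℕ.≤-refl)) (corner-full-rows (Fin.toℕ<n t)))) ⟩
    ∑[ t < n ] ∑[ i < n ] (+ (suc (toℕ i) ⊓ suc (toℕ t)) - corner a (suc (toℕ i)) (suc (toℕ t))) ∎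
    where
    open ≡-Reasoning
    w : Fin n → Fin n → Fin n → Fin n → ℤ
    w j k i l = (+ toℕ l - + toℕ k) * a j k * a i l
    R : Fin n → Fin n → ℤ
    R t i = prefix (a i) (suc (toℕ t))
    perPair : ∀ i j →
      ∑[ k < n ] ∑[ l < n ] (w j k i l when (i <? j ×-dec k <? l)) ≡
      ∑[ t < n ] (R t j * (1ℤ - R t i) when (i <? j))
    perPair i j = begin
      ∑[ k < n ] ∑[ l < n ] (w j k i l when (i <? j ×-dec k <? l))
        ≡⟨ sum-cong {n} (λ k → trans
             (sum-cong {n} λ l → when-× (w j k i l) (i <? j) (k <? l))
             (sum-when (λ l → w j k i l when (k <? l)) (i <? j))) ⟩
      ∑[ k < n ] ((∑[ l < n ] (w j k i l when (k <? l))) when (i <? j))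
        ≡⟨ sum-when (λ k → ∑[ l < n ] (w j k i l when (k <? l))) (i <? j) ⟩
      ((∑[ k < n ] ∑[ l < n ] (w j k i l when (k <? l))) when (i <? j))
        -- The lower row j supplies the entries with the smaller column index k, the upper row i
        -- those with the larger index l.
        ≡⟨ when-cong (i <? j) (weightedPairs (a j) (a i)) ⟩
      ((∑[ t < n ] (R t j * (sum (a i) - R t i))) when (i <? j))
        ≡⟨ cong (λ s → (∑[ t < n ] (R t j * (s - R t i))) when (i <? j)) (rowSums i) ⟩
      ((∑[ t < n ] (R t j * (1ℤ - R t i))) when (i <? j))
        ≡⟨ sum-when (λ t → R t j * (1ℤ - R t i)) (i <? j) ⟨
      ∑[ t < n ] (R t j * (1ℤ - R t i) when (i <? j)) ∎

-- Corner functions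

-- The properties of ASM corner sums on which the comparison rests. They are symmetric in rows and
-- columns, so each one-sided lemma transfers along `flip`.
record CornerFunction (n : ℕ) (c : ℕ → ℕ → ℕ) : Set where
  field
    zeroˡ : ∀ q → c 0 q ≡ 0
    zeroʳ : ∀ p → c p 0 ≡ 0
    fullˡ : ∀ {q} → q ≤ n → c n q ≡ q
    fullʳ : ∀ {p} → p ≤ n → c p n ≡ p
    stepˡ : ∀ p q → c (suc p) q ≡ c p q ⊎ c (suc p) q ≡ suc (c p q)
    stepʳ : ∀ p q → c p (suc q) ≡ c p q ⊎ c p (suc q) ≡ suc (c p q)

flip-cornerFunction : ∀ {c} → CornerFunction n c → CornerFunction n (flip c)
flip-cornerFunction C = record
  { zeroˡ = zeroʳ ; zeroʳ = zeroˡ ; fullˡ = fullʳ ; fullʳ = fullˡ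
  ; stepˡ = flip stepʳ ; stepʳ = flip stepˡ }
  where open CornerFunction C

module _ {c : ℕ → ℕ → ℕ} (C : CornerFunction n c) where

  open CornerFunction C

  monoˡ : ∀ {p p′} q → p ≤ p′ → c p q ≤ c p′ q
  monoˡ q p≤p′ = go (ℕ.≤⇒≤′ p≤p′)
    where
    go : ∀ {p p′} → p ℕ.≤′ p′ → c p q ≤ c p′ q
    go ℕ.≤′-refl = ℕ.≤-refl
    go {p} {suc p′} (ℕ.≤′-step p≤p′) with stepˡ p′ q
    ... | inj₁ eq = subst (c p q ≤_) (sym eq) (go p≤p′)
    ... | inj₂ eq = subst (c p q ≤_) (sym eq) (ℕ.m≤n⇒m≤1+n (go p≤p′))

  lipschitzˡ : ∀ p d q → c (d ℕ.+ p) q ≤ d ℕ.+ c p q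
  lipschitzˡ p zero    q = ℕ.≤-refl
  lipschitzˡ p (suc d) q with stepˡ (d ℕ.+ p) q
  ... | inj₁ eq = subst (_≤ suc d ℕ.+ c p q) (sym eq) (ℕ.m≤n⇒m≤1+n (lipschitzˡ p d q))
  ... | inj₂ eq = subst (_≤ suc d ℕ.+ c p q) (sym eq) (s≤s (lipschitzˡ p d q))

  -- Truncated subtraction unites two cases: monotonicity for p ≤ p₀, and steps of at most 1 for p ≥
  -- p₀.
  bound : ∀ p p₀ q → c p q ≤ c p₀ q ℕ.+ (p ∸ p₀)
  bound p p₀ q = begin
    c p q                       ≤⟨ monoˡ q (ℕ.≤-trans (ℕ.m≤n+m∸n p p₀) (ℕ.≤-reflexive (ℕ.+-comm p₀ _))) ⟩
    c ((p ∸ p₀) ℕ.+ p₀) q       ≤⟨ lipschitzˡ p₀ (p ∸ p₀) q ⟩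
    (p ∸ p₀) ℕ.+ c p₀ q         ≡⟨ ℕ.+-comm (p ∸ p₀) _ ⟩
    c p₀ q ℕ.+ (p ∸ p₀)         ∎
    where open ℕ.≤-Reasoning

  ≤-rows : ∀ p q → c p q ≤ p
  ≤-rows p q = subst (λ z → c p q ≤ z ℕ.+ p) (zeroˡ q) (bound p 0 q)

module _ {c : ℕ → ℕ → ℕ} (C : CornerFunction n c) where

  ≤-cols : ∀ p q → c p q ≤ q
  ≤-cols p q = ≤-rows (flip-cornerFunction C) q p

  ≤-corner : ∀ p₀ q₀ p q → c p q ≤ (c p₀ q₀ ℕ.+ (q ∸ q₀)) ℕ.+ (p ∸ p₀)
  ≤-corner p₀ q₀ p q = ℕ.≤-trans (bound C p p₀ q)
    (ℕ.+-monoˡ-≤ (p ∸ p₀) (bound (flip-cornerFunction C) q q₀ p₀))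

  -- Dropping the last n - p rows lowers c n q = q by at most n - p. This later ensures that the
  -- blocks of a bigrassmannian fit into `n`.
  corner-lower : ∀ {p q} → p ≤ n → q ≤ n → p ℕ.+ q ≤ c p q ℕ.+ n
  corner-lower {p} {q} p≤n q≤n = begin
    p ℕ.+ q                     ≡⟨ cong (p ℕ.+_) (CornerFunction.fullˡ C q≤n) ⟨
    p ℕ.+ c n q                 ≤⟨ ℕ.+-monoʳ-≤ p (bound C n p q) ⟩
    p ℕ.+ (c p q ℕ.+ (n ∸ p))   ≡⟨ ℕ.+-comm p _ ⟩
    (c p q ℕ.+ (n ∸ p)) ℕ.+ p   ≡⟨ ℕ.+-assoc (c p q) _ p ⟩
    c p q ℕ.+ ((n ∸ p) ℕ.+ p)   ≡⟨ cong (c p q ℕ.+_) (ℕ.m∸n+n≡m p≤n) ⟩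
    c p q ℕ.+ n                 ∎
    where open ℕ.≤-Reasoning

-- Says c p q = min (p, q, c p₀ q₀ + (q ∸ q₀) + (p ∸ p₀)), the upper bound holding anyway.
Extremal : ℕ → (ℕ → ℕ → ℕ) → ℕ → ℕ → Set
Extremal n c p₀ q₀ = ∀ {p q x} → p ≤ n → q ≤ n →
  x ≤ p → x ≤ q → x ≤ (c p₀ q₀ ℕ.+ (q ∸ q₀)) ℕ.+ (p ∸ p₀) → x ≤ c p q

-- `e` attains the three upper bounds `≤-rows`, `≤-cols` and `≤-corner`, which `c` obeys too; the
-- third one grows with the value at (p₀, q₀).
extremal-greatest : ∀ {c e p₀ q₀} → CornerFunction n c → Extremal n e p₀ q₀ →
  c p₀ q₀ ≤ e p₀ q₀ → ∀ {p q} → p ≤ n → q ≤ n → c p q ≤ e p q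
extremal-greatest {p₀ = p₀} {q₀} C E c≤e {p} {q} p≤n q≤n = E p≤n q≤n (≤-rows C p q) (≤-cols C p q)
  (ℕ.≤-trans (≤-corner C p₀ q₀ p q) (ℕ.+-monoˡ-≤ (p ∸ p₀) (ℕ.+-monoˡ-≤ (q ∸ q₀) c≤e)))

-- Corner sums as natural numbers

module _ (A : ASM n) where

  private
    a : Matrix n
    a = entry A

  cornerℕ : ℕ → ℕ → ℕ
  cornerℕ p q = ∣ corner a p q ∣

  -- The truncated row sums are 0 or 1, so the corner sums are nonnegative and `∣_∣` loses nothing.
  +cornerℕ : ∀ p q → + cornerℕ p q ≡ corner a p q
  +cornerℕ p q = ℤ.0≤i⇒+∣i∣≡i (prefix-bits-nonneg (λ i → row-bit A i q) p)

  private
    bits⇒step : ∀ p q p′ q′ → corner a p′ q′ ≡ corner a p q ⊎ corner a p′ q′ ≡ ℤ.suc (corner a p q) →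
      cornerℕ p′ q′ ≡ cornerℕ p q ⊎ cornerℕ p′ q′ ≡ suc (cornerℕ p q)
    bits⇒step p q p′ q′ (inj₁ eq) = inj₁ (cong ∣_∣ eq)
    bits⇒step p q p′ q′ (inj₂ eq) =
      inj₂ (cong ∣_∣ (trans eq (cong ℤ.suc (sym (+cornerℕ p q)))))

  cornerFunction : CornerFunction n cornerℕ
  cornerFunction = record
    { zeroˡ = λ q → cong ∣_∣ (prefix-zero (λ i → prefix (a i) q))
    ; zeroʳ = λ p → cong ∣_∣ (trans (corner-transpose a p 0) (prefix-zero (λ j → prefix (λ i → a i j) p)))
    ; fullˡ = λ q≤n → cong ∣_∣ (corner-full-rows A q≤n)
    ; fullʳ = λ p≤n → cong ∣_∣ (corner-full-cols A p≤n)
    -- A further row adds its truncated row sum, a further column its truncated column sum; both are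
    -- 0 or 1.
    ; stepˡ = λ p q → bits⇒step p q (suc p) q (prefix-bits (λ i → row-bit A i q) p)
    ; stepʳ = λ p q → bits⇒step p q p (suc q)
        (subst₂ (λ x y → y ≡ x ⊎ y ≡ ℤ.suc x) (sym (corner-transpose a p q)) (sym (corner-transpose a p (suc q)))
          (prefix-bits (λ j → col-bit A j p) q))
    }

  cornerSum≡+cornerℕ : ∀ i j → cornerSum a i j ≡ + cornerℕ (suc (toℕ i)) (suc (toℕ j))
  cornerSum≡+cornerℕ i j = trans (cornerSum≡corner a i j) (sym (+cornerℕ _ _))

≤ᴬ⇒cornerℕ≥ : ∀ {A B : ASM n} → A ≤ᴬ B → ∀ i j →
  cornerℕ B (suc (toℕ i)) (suc (toℕ j)) ≤ cornerℕ A (suc (toℕ i)) (suc (toℕ j))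
≤ᴬ⇒cornerℕ≥ {A = A} {B} A≤B i j =
  ℤ.drop‿+≤+ (subst₂ ℤ._≤_ (cornerSum≡+cornerℕ B i j) (cornerSum≡+cornerℕ A i j) (A≤B i j))

cornerℕ≥⇒≤ᴬ : ∀ {A B : ASM n} → (∀ {p q} → p ≤ n → q ≤ n → cornerℕ B p q ≤ cornerℕ A p q) → A ≤ᴬ B
cornerℕ≥⇒≤ᴬ {A = A} {B} B≤A i j =
  subst₂ ℤ._≤_ (sym (cornerSum≡+cornerℕ B i j)) (sym (cornerSum≡+cornerℕ A i j))
    (ℤ.+≤+ (B≤A (Fin.toℕ<n i) (Fin.toℕ<n j)))

cornerℕ-cong : ∀ {A B : ASM n} → (∀ i j → entry A i j ≡ entry B i j) → ∀ p q → cornerℕ A p q ≡ cornerℕ B p q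
cornerℕ-cong eq p q = cong ∣_∣ (prefix-cong (λ i → prefix-cong (eq i) q) p)

-- Entries are mixed differences of corner sums: the outer `prefix-injective` takes differences in
-- the columns, the inner one in the rows.
cornerℕ-injective : ∀ {A B : ASM n} → (∀ {p q} → p ≤ n → q ≤ n → cornerℕ A p q ≡ cornerℕ B p q) →
  ∀ i j → entry A i j ≡ entry B i j
cornerℕ-injective {A = A} {B} eq i = prefix-injective λ q q≤n →
  prefix-injective (λ p p≤n → trans (sym (+cornerℕ A p q)) (trans (cong +_ (eq p≤n q≤n)) (+cornerℕ B p q))) i

-- Permutations and their descents

-- `p₀` is the length of the first run, so a descent at d corresponds to `suc (toℕ d)`. As x < y,
-- one bound puts both on the same side of the cut.
Increasing : (Fin n → Fin n) → ℕ → Set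
Increasing f p₀ = ∀ {x y} → x Fin.< y → toℕ y < p₀ ⊎ p₀ ≤ toℕ x → f x Fin.< f y

-- c p q is the number of x < p with f x < q, provided that c 0 q = 0.
CountsRows : (Fin n → Fin n) → (ℕ → ℕ → ℕ) → Set
CountsRows f c = ∀ x q →
  (toℕ (f x) < q → c (suc (toℕ x)) q ≡ suc (c (toℕ x) q)) ×
  (q ≤ toℕ (f x) → c (suc (toℕ x)) q ≡ c (toℕ x) q)

module _ {f : Fin n → Fin n} {c : ℕ → ℕ → ℕ} (F : CountsRows f c) where

  constant-run : ∀ s d {q} → d ℕ.+ s ≤ n →
    (∀ z → s ≤ toℕ z → toℕ z < d ℕ.+ s → q ≤ toℕ (f z)) → c (d ℕ.+ s) q ≡ c s q
  constant-run s zero    _    _    = refl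
  constant-run s (suc d) {q} d+s<n high = trans
    (subst (λ k → c (suc k) q ≡ c k q) z≡ (proj₂ (F z q) (high z
      (ℕ.≤-trans (ℕ.m≤n+m s d) (ℕ.≤-reflexive (sym z≡))) (s≤s (ℕ.≤-reflexive z≡)))))
    (constant-run s d (ℕ.<⇒≤ d+s<n) λ z s≤z z<d+s → high z s≤z (ℕ.m≤n⇒m≤1+n z<d+s))
    where
    z = fromℕ< d+s<n
    z≡ = Fin.toℕ-fromℕ< d+s<n

  full-run : ∀ s d {q} → d ℕ.+ s ≤ n →
    (∀ z → s ≤ toℕ z → toℕ z < d ℕ.+ s → toℕ (f z) < q) → c (d ℕ.+ s) q ≡ d ℕ.+ c s q
  full-run s zero    _    _    = refl
  full-run s (suc d) {q} d+s<n low = trans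
    (subst (λ k → c (suc k) q ≡ suc (c k q)) z≡ (proj₁ (F z q) (low z
      (ℕ.≤-trans (ℕ.m≤n+m s d) (ℕ.≤-reflexive (sym z≡))) (s≤s (ℕ.≤-reflexive z≡)))))
    (cong suc (full-run s d (ℕ.<⇒≤ d+s<n) λ z s≤z z<d+s → low z s≤z (ℕ.m≤n⇒m≤1+n z<d+s)))
    where
    z = fromℕ< d+s<n
    z≡ = Fin.toℕ-fromℕ< d+s<n

  constant-on : ∀ {s e q} → s ≤ e → e ≤ n →
    (∀ z → s ≤ toℕ z → toℕ z < e → q ≤ toℕ (f z)) → c e q ≡ c s q
  constant-on {s} {e} {q} s≤e e≤n high = subst (λ k → c k q ≡ c s q) eq
    (constant-run s (e ∸ s) (subst (_≤ n) (sym eq) e≤n) λ z s≤z z<e → high z s≤z (subst (toℕ z <_) eq z<e))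
    where eq = ℕ.m∸n+n≡m s≤e

  full-on : ∀ {s e q} → s ≤ e → e ≤ n →
    (∀ z → s ≤ toℕ z → toℕ z < e → toℕ (f z) < q) → c e q ≡ (e ∸ s) ℕ.+ c s q
  full-on {s} {e} {q} s≤e e≤n low = subst (λ k → c k q ≡ (e ∸ s) ℕ.+ c s q) eq
    (full-run s (e ∸ s) (subst (_≤ n) (sym eq) e≤n) λ z s≤z z<e → low z s≤z (subst (toℕ z <_) eq z<e))
    where eq = ℕ.m∸n+n≡m s≤e

  private
    last≤ : ∀ {z z′ : Fin n} {p₀} → Increasing f p₀ → toℕ z′ ≤ toℕ z → toℕ z < p₀ ⊎ p₀ ≤ toℕ z′ →
      f z′ Fin.≤ f z
    last≤ inc z′≤z side with ℕ.m≤n⇒m<n∨m≡n z′≤z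
    ... | inj₁ z′<z = ℕ.<⇒≤ (inc z′<z side)
    ... | inj₂ z′≡z = ℕ.≤-reflexive (cong (toℕ ∘ f) (Fin.toℕ-injective z′≡z))

  -- Within each of the two increasing runs the rows counted by c precede those which are not.
  lower-from-increasing : CornerFunction n c → ∀ {p₀} → p₀ ≤ n → Increasing f p₀ →
    ∀ {p q x} → p ≤ n → q ≤ n → x ≤ p → x ≤ q → x ≤ c p₀ q ℕ.+ (p ∸ p₀) → x ≤ c p q
  lower-from-increasing C p₀≤n inc {zero} p≤n q≤n x≤p x≤q x≤c = ℕ.≤-trans x≤p z≤n
  lower-from-increasing C {p₀} p₀≤n inc {suc p} {q} {x} p<n q≤n x≤p x≤q x≤c
    -- The last row p decides which bound is attained. If it is counted, so are all rows of its run
    -- before it, giving p + 1 or c p₀ q + (p + 1 - p₀). If not, no later row of its run is counted,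
    -- giving c p₀ q or c n q = q.
    with toℕ (f (fromℕ< p<n)) ℕ.<? q | p ℕ.<? p₀
  ... | yes fp<q | yes p<p₀ = subst (x ≤_) (sym (trans
          (full-on {0} z≤n p<n λ z _ z≤p → ℕ.≤-<-trans (last≤ inc (subst (toℕ z ≤_) (sym p≡) (s≤s⁻¹ z≤p))
            (inj₁ (subst (_< p₀) (sym p≡) p<p₀))) fp<q)
          (trans (cong (suc p ℕ.+_) (CornerFunction.zeroˡ C q)) (ℕ.+-identityʳ (suc p))))) x≤p
    where p≡ = Fin.toℕ-fromℕ< p<n
  ... | yes fp<q | no p≮p₀ = subst (x ≤_) (sym (trans
          (full-on (ℕ.m≤n⇒m≤1+n (ℕ.≮⇒≥ p≮p₀)) p<n λ z p₀≤z z≤p → ℕ.≤-<-trans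
            (last≤ inc (subst (toℕ z ≤_) (sym p≡) (s≤s⁻¹ z≤p)) (inj₂ p₀≤z)) fp<q)
          (ℕ.+-comm (suc p ∸ p₀) (c p₀ q)))) x≤c
    where p≡ = Fin.toℕ-fromℕ< p<n
  ... | no fp≮q | yes p<p₀ = subst (x ≤_) (trans
          (cong (c p₀ q ℕ.+_) (ℕ.m≤n⇒m∸n≡0 p<p₀)) (trans (ℕ.+-identityʳ _)
          (constant-on p<p₀ p₀≤n λ z p<z z<p₀ → ℕ.≤-trans (ℕ.≮⇒≥ fp≮q)
            (last≤ inc (subst (_≤ toℕ z) (sym p≡) (ℕ.<⇒≤ p<z)) (inj₁ z<p₀))))) x≤c
    where p≡ = Fin.toℕ-fromℕ< p<n
  ... | no fp≮q | no p≮p₀ = subst (x ≤_) (trans (sym (CornerFunction.fullˡ C q≤n))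
          (constant-on p<n ℕ.≤-refl λ z p<z z<n → ℕ.≤-trans (ℕ.≮⇒≥ fp≮q)
            (last≤ inc (subst (_≤ toℕ z) (sym p≡) (ℕ.<⇒≤ p<z)) (inj₂ (subst (p₀ ≤_) (sym p≡) (ℕ.≮⇒≥ p≮p₀)))))) x≤q
    where p≡ = Fin.toℕ-fromℕ< p<n

-- The bound is transported in two moves: from (p₀, q₀) to (p₀, q) by the increasing columns, then
-- from (p₀, q) to (p, q) by the increasing rows. For the first move `x` is lowered by p ∸ p₀.
increasing⇒extremal : ∀ {f g : Fin n → Fin n} {c} → CornerFunction n c →
  CountsRows f c → CountsRows g (flip c) →
  ∀ {p₀ q₀} → p₀ ≤ n → q₀ ≤ n → Increasing f p₀ → Increasing g q₀ → Extremal n c p₀ q₀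
increasing⇒extremal {c = c} C F G {p₀} {q₀} p₀≤n q₀≤n incf incg {p} {q} {x} p≤n q≤n x≤p x≤q x≤c =
  lower-from-increasing F C p₀≤n incf p≤n q≤n x≤p x≤q (begin
    x                              ≤⟨ ℕ.m≤n+m∸n x (p ∸ p₀) ⟩
    (p ∸ p₀) ℕ.+ (x ∸ (p ∸ p₀))    ≡⟨ ℕ.+-comm (p ∸ p₀) _ ⟩
    (x ∸ (p ∸ p₀)) ℕ.+ (p ∸ p₀)    ≤⟨ ℕ.+-monoˡ-≤ (p ∸ p₀) (lower-from-increasing G (flip-cornerFunction C) q₀≤n incg q≤n p₀≤n
         (ℕ.≤-trans (ℕ.m∸n≤m x (p ∸ p₀)) x≤q)
         (ℕ.m≤n+o⇒m∸n≤o x (p ∸ p₀) (ℕ.≤-trans x≤p (ℕ.≤-trans (ℕ.m≤n+m∸n p p₀) (ℕ.≤-reflexive (ℕ.+-comm p₀ _)))))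
         (ℕ.m≤n+o⇒m∸n≤o x (p ∸ p₀) (ℕ.≤-trans x≤c (ℕ.≤-reflexive (ℕ.+-comm _ (p ∸ p₀)))))) ⟩
    c p₀ q ℕ.+ (p ∸ p₀)            ∎)
  where open ℕ.≤-Reasoning

when-true : {P : Set} {x : ℤ} (P? : Dec P) → P → (x when P?) ≡ x
when-true {x = x} P? p = cong (λ b → if b then x else 0ℤ) (dec-true P? p)

when-false : {P : Set} {x : ℤ} (P? : Dec P) → ¬ P → (x when P?) ≡ 0ℤ
when-false {x = x} P? ¬p = cong (λ b → if b then x else 0ℤ) (dec-false P? ¬p)

when-bit : {P : Set} (P? : Dec P) → Bit (1ℤ when P?)
when-bit P? with does P?
... | true  = inj₂ refl
... | false = inj₁ refl

prefix-indicator : ∀ (x : Fin n) q → prefix (λ k → 1ℤ when (k Fin.≟ x)) q ≡ (1ℤ when (toℕ x ℕ.<? q))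
prefix-indicator zero    zero    = refl
prefix-indicator {suc n} zero (suc q) = cong ℤ.suc (prefix-0s n q)
prefix-indicator (suc x) zero    = refl
prefix-indicator (suc x) (suc q) = trans (ℤ.+-identityˡ _) (prefix-indicator x q)

module _ (v : Permutation′ n) where

  prefix-permutation-row : ∀ i q → prefix (permutationMatrix v i) q ≡ (1ℤ when (toℕ (v ⟨$⟩ʳ i) ℕ.<? q))
  prefix-permutation-row i = prefix-indicator (v ⟨$⟩ʳ i)

  prefix-permutation-col : ∀ j p →
    prefix (λ i → permutationMatrix v i j) p ≡ (1ℤ when (toℕ (v ⟨$⟩ˡ j) ℕ.<? p))
  prefix-permutation-col j p = trans
    (prefix-cong (λ i → cong (λ b → if b then 1ℤ else 0ℤ) (does-⇔ (mk⇔
      (λ { refl → sym (Perm.inverseˡ v) }) (λ { refl → sym (Perm.inverseʳ v) })) (j Fin.≟ v ⟨$⟩ʳ i) (i Fin.≟ v ⟨$⟩ˡ j))) p)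
    (prefix-indicator (v ⟨$⟩ˡ j) p)

  permutationASM : ASM n
  permutationASM = mkASM (permutationMatrix v) record
    { entries        = λ i j → inj₂ (when-bit (j Fin.≟ v ⟨$⟩ʳ i))
    ; rowPartialSums = λ i j → subst Bit (sym (trans (sum-≤? (permutationMatrix v i) j) (prefix-permutation-row i _)))
                         (when-bit (toℕ (v ⟨$⟩ʳ i) ℕ.<? suc (toℕ j)))
    ; colPartialSums = λ i j → subst Bit (sym (trans (sum-≤? (λ k → permutationMatrix v k j) i) (prefix-permutation-col j _)))
                         (when-bit (toℕ (v ⟨$⟩ˡ j) ℕ.<? suc (toℕ i)))
    ; rowSums        = λ i → total (prefix-permutation-row i n)
    ; colSums        = λ j → total (prefix-permutation-col j n)
    }
    where
    total : ∀ {f : Fin n → ℤ} {x : Fin n} → prefix f n ≡ (1ℤ when (toℕ x ℕ.<? n)) → sum f ≡ 1ℤ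
    total {f} {x} eq = trans (sym (prefix-total f ℕ.≤-refl)) (trans eq (when-true (toℕ x ℕ.<? n) (Fin.toℕ<n x)))

-- Row x contributes its truncated sum, 1 or 0. A bare matrix is taken so that the transpose of an
-- ASM is covered.
corner-countsRows : ∀ (b : Matrix n) (f : Fin n → Fin n) {c} →
  (∀ x q → prefix (b x) q ≡ (1ℤ when (toℕ (f x) ℕ.<? q))) →
  (∀ p q → + c p q ≡ corner b p q) → CountsRows f c
corner-countsRows b f {c} rows c≡ x q =
  (λ lt → ℤ.+-injective (trans step (cong (_+ + c (toℕ x) q) (when-true (toℕ (f x) ℕ.<? q) lt)))) ,
  (λ ge → ℤ.+-injective (trans step (trans (cong (_+ + c (toℕ x) q) (when-false (toℕ (f x) ℕ.<? q) (ℕ.≤⇒≯ ge)))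
                                            (ℤ.+-identityˡ _))))
  where
  step : + c (suc (toℕ x)) q ≡ (1ℤ when (toℕ (f x) ℕ.<? q)) + + c (toℕ x) q
  step = trans (c≡ _ q) (trans (prefix-suc (λ i → prefix (b i) q) x)
           (cong₂ _+_ (rows x q) (sym (c≡ _ q))))

module _ (A : ASM n) (v : Permutation′ n) (A≡v : ∀ i j → entry A i j ≡ permutationMatrix v i j) where

  permutation-countsRows : CountsRows (v ⟨$⟩ʳ_) (cornerℕ A)
  permutation-countsRows = corner-countsRows (entry A) (v ⟨$⟩ʳ_)
    (λ i q → trans (prefix-cong (A≡v i) q) (prefix-permutation-row v i q)) (+cornerℕ A)

  permutation-countsCols : CountsRows (v ⟨$⟩ˡ_) (flip (cornerℕ A))
  permutation-countsCols = corner-countsRows (flip (entry A)) (v ⟨$⟩ˡ_)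
    (λ j p → trans (prefix-cong (λ i → A≡v i j) p) (prefix-permutation-col v j p))
    (λ p q → trans (+cornerℕ A q p) (corner-transpose (entry A) q p))

-- By injectivity every adjacent pair other than the one at `d` ascends, and the chain from x to y
-- stays on one side of the cut.
uniqueDescent⇒increasing : ∀ {f : Fin n → Fin n} {d} → (∀ {x y} → f x ≡ f y → x ≡ y) →
  (∀ {x} → Descent f x → d ≡ x) → Increasing f (suc (toℕ d))
uniqueDescent⇒increasing {n} {f} {d} inj uniq {x} {y} x<y side =
  -- The induction runs over the number of indices strictly between x and y.
  go (toℕ y ∸ suc (toℕ x)) y (sym (trans (sym (ℕ.+-suc _ (toℕ x))) (ℕ.m∸n+n≡m x<y))) side
  where
  ascent : ∀ {z z′} → toℕ z′ ≡ suc (toℕ z) → d ≢ z → f z Fin.< f z′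
  ascent {z} {z′} z′≡ d≢z with Fin.<-cmp (f z) (f z′)
  ... | tri< lt _ _ = lt
  ... | tri≈ _ eq _ = contradiction (trans (cong toℕ (inj eq)) z′≡) (λ e → ℕ.1+n≢n (sym e))
  ... | tri> _ _ gt = contradiction (uniq (z′ , z′≡ , gt)) d≢z

  go : ∀ k y → toℕ y ≡ suc (k ℕ.+ toℕ x) → toℕ y < suc (toℕ d) ⊎ suc (toℕ d) ≤ toℕ x → f x Fin.< f y
  go zero y y≡ side = ascent y≡ (avoid side)
    where
    avoid : toℕ y < suc (toℕ d) ⊎ suc (toℕ d) ≤ toℕ x → d ≢ x
    avoid (inj₁ y≤d) refl = ℕ.1+n≰n (subst (_≤ toℕ d) y≡ (s≤s⁻¹ y≤d))
    avoid (inj₂ d<x) refl = ℕ.1+n≰n d<x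
  go (suc k) y y≡ side = Fin.<-trans (go k y⁻ y⁻≡ (side⁻ side)) (ascent (trans y≡ (cong suc (sym y⁻≡))) (avoid side))
    where
    y⁻<n : suc (k ℕ.+ toℕ x) < n
    y⁻<n = ℕ.<-trans (subst (suc (k ℕ.+ toℕ x) <_) (sym y≡) ℕ.≤-refl) (Fin.toℕ<n y)
    y⁻ : Fin n
    y⁻ = fromℕ< y⁻<n
    y⁻≡ : toℕ y⁻ ≡ suc (k ℕ.+ toℕ x)
    y⁻≡ = Fin.toℕ-fromℕ< y⁻<n
    y⁻<y : toℕ y⁻ < toℕ y
    y⁻<y = ℕ.≤-reflexive (trans (cong suc y⁻≡) (sym y≡))
    side⁻ : toℕ y < suc (toℕ d) ⊎ suc (toℕ d) ≤ toℕ x → toℕ y⁻ < suc (toℕ d) ⊎ suc (toℕ d) ≤ toℕ x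
    side⁻ (inj₁ y≤d) = inj₁ (ℕ.<-trans y⁻<y y≤d)
    side⁻ (inj₂ d<x) = inj₂ d<x
    avoid : toℕ y < suc (toℕ d) ⊎ suc (toℕ d) ≤ toℕ x → d ≢ y⁻
    avoid (inj₁ y≤d) d≡ = ℕ.<-irrefl (cong toℕ (sym d≡)) (ℕ.<-≤-trans y⁻<y (s≤s⁻¹ y≤d))
    avoid (inj₂ d<x) d≡ = ℕ.<-irrefl (trans (cong toℕ d≡) y⁻≡)
      (ℕ.≤-trans d<x (ℕ.≤-trans (ℕ.m≤n+m (toℕ x) k) (ℕ.n≤1+n _)))

-- A descent at any other place would lie inside one of the two runs.
increasing⇒uniqueDescent : ∀ {f : Fin n → Fin n} {d} → Increasing f (suc (toℕ d)) →
  ∀ {x} → Descent f x → d ≡ x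
increasing⇒uniqueDescent {f = f} {d} inc {x} (x′ , x′≡ , fx>fx′) with Fin.<-cmp x d
... | tri≈ _ eq _ = sym eq
... | tri< x<d _ _ = contradiction (inc (ℕ.≤-reflexive (sym x′≡)) (inj₁ (s≤s (subst (_≤ toℕ d) (sym x′≡) x<d))))
                                   (ℕ.<-asym fx>fx′)
... | tri> _ _ d<x = contradiction (inc (ℕ.≤-reflexive (sym x′≡)) (inj₂ d<x)) (ℕ.<-asym fx>fx′)

-- Row d is not counted: otherwise f (d + 1) < f d < q₀ would lie in the first run of the inverse
-- `g`, and d + 1 would precede d. So at most the d rows before it are counted.
descent⇒corner≤ : ∀ {f g : Fin n → Fin n} {c q₀ d} → CornerFunction n c → CountsRows f c →
  (∀ x → g (f x) ≡ x) → Increasing g q₀ → Descent f d → c (suc (toℕ d)) q₀ ≤ toℕ d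
descent⇒corner≤ {f = f} {g} {c} {q₀} {d} C F gf inc (d′ , d′≡ , fd>fd′) with toℕ (f d) ℕ.<? q₀
... | no  fd≮q₀ = subst (_≤ toℕ d) (sym (proj₂ (F d q₀) (ℕ.≮⇒≥ fd≮q₀))) (≤-rows C (toℕ d) q₀)
... | yes fd<q₀ = contradiction (subst₂ Fin._<_ (gf d′) (gf d) (inc fd>fd′ (inj₁ fd<q₀)))
                                (ℕ.≤⇒≯ (ℕ.≤-trans (ℕ.n≤1+n _) (ℕ.≤-reflexive (sym d′≡))))

-- Bigrassmannian permutations

-- Exchanges two adjacent blocks of sizes a and b, after r fixed points.
swapBlocks : ℕ → ℕ → ℕ → ℕ → ℕ
swapBlocks r a b x with x ℕ.<? r | x ℕ.<? r ℕ.+ a | x ℕ.<? (r ℕ.+ a) ℕ.+ b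
... | yes _ | _     | _     = x
... | no  _ | yes _ | _     = x ℕ.+ b
... | no  _ | no  _ | yes _ = x ∸ a
... | no  _ | no  _ | no  _ = x

module _ (r a b : ℕ) {x : ℕ} where

  swapBlocks-low : x < r → swapBlocks r a b x ≡ x
  swapBlocks-low x<r with x ℕ.<? r
  ... | yes _  = refl
  ... | no x≮r = contradiction x<r x≮r

  swapBlocks-up : r ≤ x → x < r ℕ.+ a → swapBlocks r a b x ≡ x ℕ.+ b
  swapBlocks-up r≤x x<r+a with x ℕ.<? r | x ℕ.<? r ℕ.+ a
  ... | yes x<r | _       = contradiction x<r (ℕ.≤⇒≯ r≤x)
  ... | no  _   | yes _   = refl
  ... | no  _   | no  x≮  = contradiction x<r+a x≮

  swapBlocks-down : r ℕ.+ a ≤ x → x < (r ℕ.+ a) ℕ.+ b → swapBlocks r a b x ≡ x ∸ a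
  swapBlocks-down r+a≤x x<r+a+b with x ℕ.<? r | x ℕ.<? r ℕ.+ a | x ℕ.<? (r ℕ.+ a) ℕ.+ b
  ... | yes x<r | _      | _     = contradiction x<r (ℕ.≤⇒≯ (ℕ.m+n≤o⇒m≤o r r+a≤x))
  ... | no  _   | yes x< | _     = contradiction x< (ℕ.≤⇒≯ r+a≤x)
  ... | no  _   | no  _  | yes _ = refl
  ... | no  _   | no  _  | no x≮ = contradiction x<r+a+b x≮

  swapBlocks-high : (r ℕ.+ a) ℕ.+ b ≤ x → swapBlocks r a b x ≡ x
  swapBlocks-high r+a+b≤x with x ℕ.<? r | x ℕ.<? r ℕ.+ a | x ℕ.<? (r ℕ.+ a) ℕ.+ b
  ... | yes _ | _      | _      = refl
  ... | no  _ | yes x< | _      = contradiction x< (ℕ.≤⇒≯ (ℕ.m+n≤o⇒m≤o (r ℕ.+ a) r+a+b≤x))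
  ... | no  _ | no  _  | yes x< = contradiction x< (ℕ.≤⇒≯ r+a+b≤x)
  ... | no  _ | no  _  | no _   = refl

data Zone (r a b x : ℕ) : Set where
  low  : x < r → Zone r a b x
  up   : r ≤ x → x < r ℕ.+ a → Zone r a b x
  down : r ℕ.+ a ≤ x → x < (r ℕ.+ a) ℕ.+ b → Zone r a b x
  high : (r ℕ.+ a) ℕ.+ b ≤ x → Zone r a b x

zone : ∀ r a b x → Zone r a b x
zone r a b x with x ℕ.<? r | x ℕ.<? r ℕ.+ a | x ℕ.<? (r ℕ.+ a) ℕ.+ b
... | yes x<r | _       | _     = low x<r
... | no  x≮r | yes x<  | _     = up (ℕ.≮⇒≥ x≮r) x<
... | no  _   | no  x≮  | yes x< = down (ℕ.≮⇒≥ x≮) x<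
... | no  _   | no  _   | no x≮ = high (ℕ.≮⇒≥ x≮)

+-right-comm : ∀ r a b → (r ℕ.+ a) ℕ.+ b ≡ (r ℕ.+ b) ℕ.+ a
+-right-comm r a b = trans (ℕ.+-assoc r a b) (trans (cong (r ℕ.+_) (ℕ.+-comm a b)) (sym (ℕ.+-assoc r b a)))

module _ (r a b : ℕ) where

  private
    σ = swapBlocks r a b

    a≤ : ∀ {x} → r ℕ.+ a ≤ x → a ≤ x
    a≤ = ℕ.m+n≤o⇒n≤o r

    ∸<∸ : ∀ {x} → r ℕ.+ a ≤ x → x < (r ℕ.+ a) ℕ.+ b → x ∸ a < r ℕ.+ b
    ∸<∸ {x} r+a≤x x< = subst (x ∸ a <_) (trans (cong (_∸ a) (+-right-comm r a b)) (ℕ.m+n∸n≡m (r ℕ.+ b) a))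
      (ℕ.∸-monoˡ-< x< (a≤ r+a≤x))

    r≤∸ : ∀ {x} → r ℕ.+ a ≤ x → r ≤ x ∸ a
    r≤∸ {x} r+a≤x = subst (_≤ x ∸ a) (ℕ.m+n∸n≡m r a) (ℕ.∸-monoˡ-≤ a r+a≤x)

  -- After the exchange the block of size `b` comes first, so the sizes trade places and `up`
  -- corresponds to `down`.
  swapBlocks-inverse : ∀ x → swapBlocks r b a (σ x) ≡ x
  swapBlocks-inverse x with zone r a b x
  ... | low x<r = trans (cong (swapBlocks r b a) (swapBlocks-low r a b x<r)) (swapBlocks-low r b a x<r)
  ... | up r≤x x<r+a = trans (cong (swapBlocks r b a) (swapBlocks-up r a b r≤x x<r+a))
        (trans (swapBlocks-down r b a (ℕ.+-monoˡ-≤ b r≤x) (subst (x ℕ.+ b <_) (+-right-comm r a b) (ℕ.+-monoˡ-< b x<r+a)))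
               (ℕ.m+n∸n≡m x b))
  ... | down r+a≤x x< = trans (cong (swapBlocks r b a) (swapBlocks-down r a b r+a≤x x<))
        (trans (swapBlocks-up r b a (r≤∸ r+a≤x) (∸<∸ r+a≤x x<)) (ℕ.m∸n+n≡m (a≤ r+a≤x)))
  ... | high ≤x = trans (cong (swapBlocks r b a) (swapBlocks-high r a b ≤x))
        (swapBlocks-high r b a (subst (_≤ x) (+-right-comm r a b) ≤x))

  swapBlocks-< : (r ℕ.+ a) ℕ.+ b ≤ n → ∀ {x} → x < n → σ x < n
  swapBlocks-< {n} ≤n {x} x<n with zone r a b x
  ... | low x<r = subst (_< n) (sym (swapBlocks-low r a b x<r)) x<n
  ... | up r≤x x<r+a = subst (_< n) (sym (swapBlocks-up r a b r≤x x<r+a)) (ℕ.<-≤-trans (ℕ.+-monoˡ-< b x<r+a) ≤n)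
  ... | down r+a≤x x< = subst (_< n) (sym (swapBlocks-down r a b r+a≤x x<)) (ℕ.≤-<-trans (ℕ.m∸n≤m x a) x<n)
  ... | high ≤x = subst (_< n) (sym (swapBlocks-high r a b ≤x)) x<n

  -- The displacements are 0, then b, before the cut r + a, and -a, then 0, after it; on neither
  -- side do they decrease.
  swapBlocks-increasing : ∀ {x y} → x < y → y < r ℕ.+ a ⊎ r ℕ.+ a ≤ x → σ x < σ y
  swapBlocks-increasing {x} {y} x<y (inj₁ y<r+a) with ℕ.<-≤-connex y r | ℕ.<-≤-connex x r
  ... | inj₁ y<r | _ = subst₂ _<_ (sym (swapBlocks-low r a b (ℕ.<-trans x<y y<r))) (sym (swapBlocks-low r a b y<r)) x<y
  ... | inj₂ r≤y | inj₁ x<r = subst₂ _<_ (sym (swapBlocks-low r a b x<r)) (sym (swapBlocks-up r a b r≤y y<r+a))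
        (ℕ.<-≤-trans x<y (ℕ.m≤m+n y b))
  ... | inj₂ r≤y | inj₂ r≤x = subst₂ _<_ (sym (swapBlocks-up r a b r≤x (ℕ.<-trans x<y y<r+a)))
        (sym (swapBlocks-up r a b r≤y y<r+a)) (ℕ.+-monoˡ-< b x<y)
  swapBlocks-increasing {x} {y} x<y (inj₂ r+a≤x) with ℕ.<-≤-connex y ((r ℕ.+ a) ℕ.+ b) | ℕ.<-≤-connex x ((r ℕ.+ a) ℕ.+ b)
  ... | inj₁ y< | _ = subst₂ _<_ (sym (swapBlocks-down r a b r+a≤x (ℕ.<-trans x<y y<)))
        (sym (swapBlocks-down r a b (ℕ.≤-trans r+a≤x (ℕ.<⇒≤ x<y)) y<)) (ℕ.∸-monoˡ-< x<y (a≤ r+a≤x))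
  ... | inj₂ ≤y | inj₁ x< = subst₂ _<_ (sym (swapBlocks-down r a b r+a≤x x<)) (sym (swapBlocks-high r a b ≤y))
        (ℕ.≤-<-trans (ℕ.m∸n≤m x a) x<y)
  ... | inj₂ ≤y | inj₂ ≤x = subst₂ _<_ (sym (swapBlocks-high r a b ≤x)) (sym (swapBlocks-high r a b ≤y)) x<y

module _ (r a b : ℕ) (≤n : (r ℕ.+ a) ℕ.+ b ≤ n) where

  swapBlocksFin : Fin n → Fin n
  swapBlocksFin x = fromℕ< (swapBlocks-< r a b ≤n (Fin.toℕ<n x))

  toℕ-swapBlocksFin : ∀ x → toℕ (swapBlocksFin x) ≡ swapBlocks r a b (toℕ x)
  toℕ-swapBlocksFin x = Fin.toℕ-fromℕ< _

  swapBlocksFin-increasing : ∀ {p₀} → r ℕ.+ a ≡ p₀ → Increasing swapBlocksFin p₀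
  swapBlocksFin-increasing refl x<y side =
    subst₂ _<_ (sym (toℕ-swapBlocksFin _)) (sym (toℕ-swapBlocksFin _)) (swapBlocks-increasing r a b x<y side)

  -- `d` is the last position of the first block and goes to d + b; the next position begins the
  -- second block and goes to r.
  swapBlocksFin-descent : ∀ d → r ℕ.+ a ≡ suc (toℕ d) → r ≤ toℕ d → 0 < b → Descent swapBlocksFin d
  swapBlocksFin-descent d r+a≡ r≤d 0<b = d′ , trans d′≡ r+a≡ ,
    subst₂ _<_ (sym (trans (toℕ-swapBlocksFin d′) (trans (cong (swapBlocks r a b) d′≡)
                 (trans (swapBlocks-down r a b ℕ.≤-refl r+a<) (ℕ.m+n∸n≡m r a)))))
               (sym (trans (toℕ-swapBlocksFin d) (swapBlocks-up r a b r≤d (ℕ.≤-reflexive (sym r+a≡)))))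
               (ℕ.≤-<-trans r≤d (ℕ.m<m+n (toℕ d) 0<b))
    where
    r+a< : r ℕ.+ a < (r ℕ.+ a) ℕ.+ b
    r+a< = ℕ.m<m+n (r ℕ.+ a) 0<b
    d′ : Fin n
    d′ = fromℕ< (ℕ.<-≤-trans r+a< ≤n)
    d′≡ : toℕ d′ ≡ r ℕ.+ a
    d′≡ = Fin.toℕ-fromℕ< _

  -- The r fixed rows are counted; the a rows of the first block go to columns from r + b on and are
  -- not.
  swapBlocksFin-corner : ∀ {c} → CornerFunction n c → CountsRows swapBlocksFin c →
    c (r ℕ.+ a) (r ℕ.+ b) ≡ r
  swapBlocksFin-corner {c} C F = trans
    (constant-on {c = c} F (ℕ.m≤m+n r a) (ℕ.m+n≤o⇒m≤o (r ℕ.+ a) ≤n) λ z r≤z z< →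
      subst (r ℕ.+ b ≤_) (sym (trans (toℕ-swapBlocksFin z) (swapBlocks-up r a b r≤z z<))) (ℕ.+-monoˡ-≤ b r≤z))
    (trans (full-on {c = c} F z≤n (ℕ.m+n≤o⇒m≤o r (ℕ.m+n≤o⇒m≤o (r ℕ.+ a) ≤n)) λ z _ z<r →
        subst (_< r ℕ.+ b) (sym (trans (toℕ-swapBlocksFin z) (swapBlocks-low r a b z<r))) (ℕ.<-≤-trans z<r (ℕ.m≤m+n r b)))
      (trans (cong (r ℕ.+_) (CornerFunction.zeroˡ C (r ℕ.+ b))) (ℕ.+-identityʳ r)))

swapBlocksFin-inverse : ∀ r a b (≤n : (r ℕ.+ a) ℕ.+ b ≤ n) (≤n′ : (r ℕ.+ b) ℕ.+ a ≤ n) x →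
  swapBlocksFin r b a ≤n′ (swapBlocksFin r a b ≤n x) ≡ x
swapBlocksFin-inverse r a b ≤n ≤n′ x = Fin.toℕ-injective (trans (toℕ-swapBlocksFin r b a ≤n′ _)
  (trans (cong (swapBlocks r b a) (toℕ-swapBlocksFin r a b ≤n x)) (swapBlocks-inverse r a b (toℕ x))))

blockPermutation : ∀ r a b → (r ℕ.+ a) ℕ.+ b ≤ n → Permutation′ n
blockPermutation {n} r a b ≤n = Perm.permutation (swapBlocksFin r a b ≤n) (swapBlocksFin r b a ≤n′)
  (swapBlocksFin-inverse r b a ≤n′ ≤n) (swapBlocksFin-inverse r a b ≤n ≤n′)
  where
  ≤n′ : (r ℕ.+ b) ℕ.+ a ≤ n
  ≤n′ = subst (_≤ n) (+-right-comm r a b) ≤n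

-- `IsBigrassmannian` with its pair of descents exposed. The descent `k` of the inverse is a column
-- and `l` is a row, so corner sums are taken at (l, k).
BigrassmannianAt : ASM n → Fin n → Fin n → Set
BigrassmannianAt {n} A k l = ∃[ v ]
  (((Descent (v ⟨$⟩ˡ_) k × Descent (v ⟨$⟩ʳ_) l) ×
    (∀ {y} → Descent (v ⟨$⟩ˡ_) (proj₁ y) × Descent (v ⟨$⟩ʳ_) (proj₂ y) → (k , l) ≡ y)) ×
   (∀ i j → entry A i j ≡ permutationMatrix {n} v i j))

module _ {A : ASM n} {k l : Fin n} (big : BigrassmannianAt A k l) where

  private
    v = proj₁ big
    desc = proj₁ (proj₁ (proj₂ big))
    uniq = proj₂ (proj₁ (proj₂ big))
    A≡v = proj₂ (proj₂ big)

    row-inc : Increasing (v ⟨$⟩ʳ_) (suc (toℕ l))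
    row-inc = uniqueDescent⇒increasing
      (λ eq → trans (sym (Perm.inverseˡ v)) (trans (cong (v ⟨$⟩ˡ_) eq) (Perm.inverseˡ v)))
      -- Pairing any descent of `v` with the known descent of its inverse turns uniqueness of the
      -- pair into uniqueness of one coordinate.
      (λ dx → cong proj₂ (uniq (proj₁ desc , dx)))

    col-inc : Increasing (v ⟨$⟩ˡ_) (suc (toℕ k))
    col-inc = uniqueDescent⇒increasing
      (λ eq → trans (sym (Perm.inverseʳ v)) (trans (cong (v ⟨$⟩ʳ_) eq) (Perm.inverseʳ v)))
      (λ dx → cong proj₁ (uniq (dx , proj₂ desc)))

  bigrassmannian-extremal : Extremal n (cornerℕ A) (suc (toℕ l)) (suc (toℕ k))
  bigrassmannian-extremal = increasing⇒extremal (cornerFunction A)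
    (permutation-countsRows A v A≡v) (permutation-countsCols A v A≡v) (Fin.toℕ<n l) (Fin.toℕ<n k) row-inc col-inc

  bigrassmannian-corner< : cornerℕ A (suc (toℕ l)) (suc (toℕ k)) < suc (toℕ l) ⊓ suc (toℕ k)
  bigrassmannian-corner< = ℕ.⊓-pres-m<
    (s≤s (descent⇒corner≤ (cornerFunction A) (permutation-countsRows A v A≡v)
      (λ _ → Perm.inverseˡ v) col-inc (proj₂ desc)))
    (s≤s (descent⇒corner≤ (flip-cornerFunction (cornerFunction A)) (permutation-countsCols A v A≡v)
      (λ _ → Perm.inverseʳ v) row-inc (proj₁ desc)))

-- Both are extremal at the same place with the same value, so each dominates the other.
bigrassmannian-unique : ∀ {A B : ASM n} {k l} → BigrassmannianAt A k l → BigrassmannianAt B k l →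
  cornerℕ A (suc (toℕ l)) (suc (toℕ k)) ≡ cornerℕ B (suc (toℕ l)) (suc (toℕ k)) →
  ∀ i j → entry A i j ≡ entry B i j
bigrassmannian-unique {A = A} {B} bigA bigB eq = cornerℕ-injective {A = A} {B} λ p≤n q≤n → ℕ.≤-antisym
  (extremal-greatest (cornerFunction A) (bigrassmannian-extremal {A = B} bigB) (ℕ.≤-reflexive eq) p≤n q≤n)
  (extremal-greatest (cornerFunction B) (bigrassmannian-extremal {A = A} bigA) (ℕ.≤-reflexive (sym eq)) p≤n q≤n)

Descent-cong : ∀ {f g : Fin n → Fin n} → f ≗ g → ∀ {x} → Descent f x → Descent g x
Descent-cong f≗g (x′ , x′≡ , fx>fx′) = x′ , x′≡ , subst₂ Fin._>_ (f≗g _) (f≗g _) fx>fx′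

permutationMatrix-injective : ∀ (v w : Permutation′ n) →
  (∀ i j → permutationMatrix v i j ≡ permutationMatrix w i j) → (v ⟨$⟩ʳ_) ≗ (w ⟨$⟩ʳ_)
permutationMatrix-injective v w eq i with (v ⟨$⟩ʳ i) Fin.≟ (w ⟨$⟩ʳ i)
... | yes vi≡wi = vi≡wi
... | no  vi≢wi with () ← trans (sym (when-true ((v ⟨$⟩ʳ i) Fin.≟ (v ⟨$⟩ʳ i)) refl))
                     (trans (eq i (v ⟨$⟩ʳ i)) (when-false ((v ⟨$⟩ʳ i) Fin.≟ (w ⟨$⟩ʳ i)) vi≢wi))

-- Equal matrices belong to permutations which agree pointwise, as do their inverses; the descents
-- of one are then descents of the other.
bigrassmannian-indices : ∀ {A B : ASM n} {k l k′ l′} →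
  BigrassmannianAt A k l → BigrassmannianAt B k′ l′ →
  (∀ i j → entry A i j ≡ entry B i j) → (k , l) ≡ (k′ , l′)
bigrassmannian-indices (v , (_ , uniq) , A≡v) (w , ((dk , dl) , _) , B≡w) A≡B =
  uniq (Descent-cong w⁻¹≗v⁻¹ dk , Descent-cong (sym ∘ v≗w) dl)
  where
  v≗w : (v ⟨$⟩ʳ_) ≗ (w ⟨$⟩ʳ_)
  v≗w = permutationMatrix-injective v w λ i j → trans (sym (A≡v i j)) (trans (A≡B i j) (B≡w i j))
  w⁻¹≗v⁻¹ : (w ⟨$⟩ˡ_) ≗ (v ⟨$⟩ˡ_)
  w⁻¹≗v⁻¹ j = trans (sym (Perm.inverseˡ v)) (cong (v ⟨$⟩ˡ_) (trans (v≗w _) (Perm.inverseʳ w)))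

-- After r fixed points, blocks of sizes l + 1 - r and k + 1 - r are exchanged. The first hypothesis
-- makes both blocks nonempty, the second says that they fit into `n`.
bigrassmannian-exists : ∀ (k l : Fin n) {r} → r < suc (toℕ l) ⊓ suc (toℕ k) →
  suc (toℕ l) ℕ.+ suc (toℕ k) ≤ r ℕ.+ n →
  ∃[ A ] (BigrassmannianAt A k l × cornerℕ A (suc (toℕ l)) (suc (toℕ k)) ≡ r)
bigrassmannian-exists {n} k l {r} r< ≤r+n = permutationASM v ,
  (v , ((swapBlocksFin-descent r b a ≤n′ k r+b≡ (s≤s⁻¹ r<k) (ℕ.m<n⇒0<n∸m r<l) ,
         swapBlocksFin-descent r a b ≤n l r+a≡ (s≤s⁻¹ r<l) (ℕ.m<n⇒0<n∸m r<k)) ,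
        λ (dk , dl) → cong₂ _,_ (increasing⇒uniqueDescent (swapBlocksFin-increasing r b a ≤n′ r+b≡) dk)
                                (increasing⇒uniqueDescent (swapBlocksFin-increasing r a b ≤n r+a≡) dl)) ,
       λ i j → refl) ,
  subst₂ (λ p q → cornerℕ (permutationASM v) p q ≡ r) r+a≡ r+b≡
    (swapBlocksFin-corner r a b ≤n (cornerFunction (permutationASM v)) (permutation-countsRows (permutationASM v) v λ i j → refl))
  where
  r<l = ℕ.m<n⊓o⇒m<n (suc (toℕ l)) (suc (toℕ k)) r<
  r<k = ℕ.m<n⊓o⇒m<o (suc (toℕ l)) (suc (toℕ k)) r<
  a b : ℕ
  a = suc (toℕ l) ∸ r
  b = suc (toℕ k) ∸ r
  r+a≡ : r ℕ.+ a ≡ suc (toℕ l)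
  r+a≡ = ℕ.m+[n∸m]≡n (ℕ.<⇒≤ r<l)
  r+b≡ : r ℕ.+ b ≡ suc (toℕ k)
  r+b≡ = ℕ.m+[n∸m]≡n (ℕ.<⇒≤ r<k)
  ≤n : (r ℕ.+ a) ℕ.+ b ≤ n
  ≤n = ℕ.+-cancelˡ-≤ r _ _ (begin
    r ℕ.+ ((r ℕ.+ a) ℕ.+ b)       ≡⟨ ℕ.+-comm r _ ⟩
    ((r ℕ.+ a) ℕ.+ b) ℕ.+ r       ≡⟨ ℕ.+-assoc (r ℕ.+ a) b r ⟩
    (r ℕ.+ a) ℕ.+ (b ℕ.+ r)       ≡⟨ cong₂ ℕ._+_ r+a≡ (trans (ℕ.+-comm b r) r+b≡) ⟩
    suc (toℕ l) ℕ.+ suc (toℕ k)   ≤⟨ ≤r+n ⟩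
    r ℕ.+ n                       ∎)
    where open ℕ.≤-Reasoning
  v = blockPermutation r a b ≤n
  ≤n′ = subst (_≤ n) (+-right-comm r a b) ≤n

-- Counting

Fin-sum↔Σ : ∀ (f : Fin n → ℕ) {B : Fin n → Set} → (∀ i → Fin (f i) ↔ B i) → Fin (ℕ-Sum.sum f) ↔ Σ (Fin n) B
Fin-sum↔Σ {zero}  f e = mk↔ₛ′ (λ ()) (λ ()) (λ ()) (λ ())
Fin-sum↔Σ {suc n} f {B} e = mk↔ₛ′ (to′ ∘ splitAt (f zero)) from to-from from-to
  where
  rest : Fin (ℕ-Sum.sum (f ∘ suc)) ↔ Σ (Fin n) (B ∘ suc)
  rest = Fin-sum↔Σ (f ∘ suc) (e ∘ suc)

  to′ : Fin (f zero) ⊎ Fin (ℕ-Sum.sum (f ∘ suc)) → Σ (Fin (suc n)) B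
  to′ (inj₁ x) = zero , Inverse.to (e zero) x
  to′ (inj₂ y) = map suc id (Inverse.to rest y)

  from : Σ (Fin (suc n)) B → Fin (ℕ-Sum.sum f)
  from (zero  , b) = Inverse.from (e zero) b ↑ˡ _
  from (suc i , b) = f zero ↑ʳ Inverse.from rest (i , b)

  to-from : ∀ s → to′ (splitAt (f zero) (from s)) ≡ s
  to-from (zero  , b) = trans (cong to′ (Fin.splitAt-↑ˡ (f zero) _ _))
                              (cong (zero ,_) (Inverse.strictlyInverseˡ (e zero) b))
  to-from (suc i , b) = trans (cong to′ (Fin.splitAt-↑ʳ (f zero) _ _))
                              (cong (map suc id) (Inverse.strictlyInverseˡ rest (i , b)))

  from-to′ : ∀ s → from (to′ s) ≡ Fin.join (f zero) _ s
  from-to′ (inj₁ x) = cong (_↑ˡ _) (Inverse.strictlyInverseʳ (e zero) x)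
  from-to′ (inj₂ y) = cong (f zero ↑ʳ_) (Inverse.strictlyInverseʳ rest y)

  from-to : ∀ x → from (to′ (splitAt (f zero) x)) ≡ x
  from-to x = trans (from-to′ (splitAt (f zero) x)) (Fin.join-splitAt (f zero) _ x)

+-sum : ∀ (f : Fin n → ℕ) → + ℕ-Sum.sum f ≡ ∑[ i < n ] (+ f i)
+-sum {zero}  f = refl
+-sum {suc n} f = trans (ℤ.pos-+ (f zero) _) (cong (_+_ (+ f zero)) (+-sum (f ∘ suc)))

+-∸ : ∀ {x y} → y ≤ x → + (x ∸ y) ≡ + x - + y
+-∸ {x} {y} y≤x = sym (trans (ℤ.m-n≡m⊖n x y) (ℤ.⊖-≥ y≤x))

hasCardinality : ∀ {c ℓ} {I : Set} (S : Setoid c ℓ) → let open Setoid S in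
  Fin m ↔ I → (F : I → Carrier) → (∀ {x y} → F x ≈ F y → x ≡ y) →
  (∀ y → ∃[ x ] F x ≈ y) → HasCardinality S m
hasCardinality S e F F-inj F-surj = record
  { to        = F ∘ to
  ; cong      = λ { refl → S.refl }
  ; bijective = (λ eq → trans (sym (strictlyInverseʳ _)) (trans (cong from (F-inj eq)) (strictlyInverseʳ _))) ,
                λ y → from (proj₁ (F-surj y)) ,
                  λ { refl → S.trans (S.reflexive (cong F (strictlyInverseˡ _))) (proj₂ (F-surj y)) }
  }
  where
  module S = Setoid S
  open Inverse e

module _ (B : ASM n) where

  -- The number of admissible corner values r at (l, k). The subtraction never truncates, by
  -- `≤-rows` and `≤-cols`.
  defect : Fin n → Fin n → ℕ
  defect k l = suc (toℕ l) ⊓ suc (toℕ k) ∸ cornerℕ B (suc (toℕ l)) (suc (toℕ k))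

  Index : Set
  Index = Σ[ k ∈ Fin n ] Σ[ l ∈ Fin n ] Fin (defect k l)

  Fin↔Index : Fin (ℕ-Sum.sum λ k → ℕ-Sum.sum (defect k)) ↔ Index
  Fin↔Index = Fin-sum↔Σ _ λ k → Fin-sum↔Σ (defect k) λ l → ↔-id _

  private
    module S = Setoid (BigrassmannianBelow B)

    value : Index → ℕ
    value (k , l , d) = cornerℕ B (suc (toℕ l)) (suc (toℕ k)) ℕ.+ toℕ d

    value< : ∀ ((k , l , d) : Index) → value (k , l , d) < suc (toℕ l) ⊓ suc (toℕ k)
    value< (k , l , d) = subst (value (k , l , d) <_) (ℕ.m+[n∸m]≡n c≤)
      (ℕ.+-monoʳ-< (cornerℕ B (suc (toℕ l)) (suc (toℕ k))) (Fin.toℕ<n d))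
      where
      c≤ : cornerℕ B (suc (toℕ l)) (suc (toℕ k)) ≤ suc (toℕ l) ⊓ suc (toℕ k)
      c≤ = ℕ.⊓-glb (≤-rows (cornerFunction B) _ _) (≤-cols (cornerFunction B) _ _)

    Element : Index → ASM n → Set
    Element x@(k , l , d) A =
      BigrassmannianAt A k l × cornerℕ A (suc (toℕ l)) (suc (toℕ k)) ≡ value x

    abstract
      element : ∀ x → ∃[ A ] Element x A
      element x@(k , l , d) = bigrassmannian-exists k l (value< x)
        -- The blocks fit because r is at least the corner sum of `B`, which obeys `corner-lower`.
        (ℕ.≤-trans (corner-lower (cornerFunction B) (Fin.toℕ<n l) (Fin.toℕ<n k))
                   (ℕ.+-monoˡ-≤ n (ℕ.m≤m+n _ (toℕ d))))

    element-≤ : ∀ {x A} → Element x A → A ≤ᴬ B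
    element-≤ {k , l , d} {A} (big , c≡) = cornerℕ≥⇒≤ᴬ {A = A} {B} (extremal-greatest
      (cornerFunction B) (bigrassmannian-extremal {A = A} big)
      (ℕ.≤-trans (ℕ.m≤m+n _ (toℕ d)) (ℕ.≤-reflexive (sym c≡))))

    -- The matrix determines its descents k and l, and then its corner sum at (l, k) determines the
    -- offset d above that of `B`.
    element-index : ∀ {x y A A′} → Element x A → Element y A′ →
      (∀ i j → entry A i j ≡ entry A′ i j) → x ≡ y
    element-index {k , l , d} {k′ , l′ , d′} {A} {A′} (big , c≡) (big′ , c≡′) A≡A′
      with refl ← bigrassmannian-indices {A = A} {A′} big big′ A≡A′ = cong (λ z → k , l , z)
        (Fin.toℕ-injective (ℕ.+-cancelˡ-≡ (cornerℕ B (suc (toℕ l)) (suc (toℕ k))) _ _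
          (trans (sym c≡) (trans (cornerℕ-cong {A = A} {A′} A≡A′ _ _) c≡′))))

    toCarrier : Index → S.Carrier
    toCarrier x = let A , el@((v , uniq , A≡v) , _) = element x in
      A , element-≤ {x} {A} el , v , (_ , uniq) , A≡v

    toCarrier-injective : ∀ {x y} → toCarrier x S.≈ toCarrier y → x ≡ y
    toCarrier-injective {x} {y} =
      element-index {x} {y} {proj₁ (element x)} {proj₁ (element y)}
        (proj₂ (element x)) (proj₂ (element y))

    -- The offset is the difference of the corner sums of `A` and `B` at the descents of `A`; the
    -- element built for it agrees with `A` by `bigrassmannian-unique`.
    toCarrier-surjective : ∀ y → ∃[ x ] toCarrier x S.≈ y
    toCarrier-surjective (A , A≤B , v , ((k , l) , uniq) , A≡v) = (k , l , d) ,
      (let A′ , big′ , c≡ = element (k , l , d) in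
       bigrassmannian-unique {A = A′} {A} big′ big (trans c≡ value≡))
      where
      big : BigrassmannianAt A k l
      big = v , uniq , A≡v
      cA cB : ℕ
      cA = cornerℕ A (suc (toℕ l)) (suc (toℕ k))
      cB = cornerℕ B (suc (toℕ l)) (suc (toℕ k))
      cB≤cA : cB ≤ cA
      cB≤cA = ≤ᴬ⇒cornerℕ≥ {A = A} {B} A≤B l k
      d< : cA ∸ cB < defect k l
      d< = ℕ.∸-monoˡ-< (bigrassmannian-corner< {A = A} big) cB≤cA
      d : Fin (defect k l)
      d = fromℕ< d<
      value≡ : value (k , l , d) ≡ cA
      value≡ = trans (cong (cB ℕ.+_) (Fin.toℕ-fromℕ< d<)) (ℕ.m+[n∸m]≡n cB≤cA)

  +sum-defect : + ℕ-Sum.sum (λ k → ℕ-Sum.sum (defect k)) ≡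
    ∑[ t < n ] ∑[ i < n ] (+ (suc (toℕ i) ⊓ suc (toℕ t)) - corner (entry B) (suc (toℕ i)) (suc (toℕ t)))
  +sum-defect = trans (+-sum {n} (λ k → ℕ-Sum.sum (defect k))) (sum-cong {n} λ k → trans (+-sum (defect k)) (sum-cong {n} λ l →
    trans (+-∸ (ℕ.⊓-glb (≤-rows (cornerFunction B) _ _) (≤-cols (cornerFunction B) _ _)))
          (cong (+ (suc (toℕ l) ⊓ suc (toℕ k)) -_) (+cornerℕ B _ _))))

  β-defect : β B ≐
    ∑[ t < n ] ∑[ i < n ] (+ (suc (toℕ i) ⊓ suc (toℕ t)) - corner (entry B) (suc (toℕ i)) (suc (toℕ t)))
  β-defect = _ , hasCardinality (BigrassmannianBelow B) Fin↔Index toCarrier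
    toCarrier-injective toCarrier-surjective , +sum-defect

theorem1p6 : (n : ℕ) → n ≥ 1 → (A : ASM n) →
    β A ≐ ∑[ i < n ] ∑[ j < n ] ∑[ k < n ] ∑[ l < n ]
    ((+ toℕ l - + toℕ k) * entry A j k * entry A i l when (i <? j ×-dec k <? l))
theorem1p6 n n≥1 A = subst (β A ≐_) (sym (weightedInversions≡cornerDefects A)) (β-defect A)
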